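{- For every integer $k \ge 186$ and every connected simple undirected graph $G$, for any choice of $S_k(G)$ and $T(G)$, $$\operatorname{leaf}(S_k(G) \cup T(G)) \ge \left(1-30\cdot\frac{1+\ln (k+1)}{k+1}\right)\operatorname{leaf}(G).$$
   Context: $\operatorname{leaf}(G)$ is the maximum number of leaves (nodes of degree one) of a spanning tree of $G$. $S_k(G)$ denotes any subgraph of $G$ that contains all nodes of $G$ and in which every node $x$ has degree at least $\min\{\deg_G(x), k\}$. $T(G)$ denotes any spanning tree of $G$. $S_k(G)\cup T(G)$ is the union subgraph (node set $V(G)$, edge set the union of the edge sets). -}

module Defs where

open import Data.Bool using (Bool; true; false; _∨_; if_then_else_)
open import Data.Nat using (ℕ; zero; suc; _+_; _*_; _≤_; _⊓_)
open import Data.Integer using (ℤ; +_)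
import Data.Integer as ℤ
open import Data.Rational using (ℚ; 0ℚ; 1ℚ; _/_)
import Data.Rational as ℚ
open import Data.Fin using (Fin)
open import Data.List using (List; []; _∷_; _++_; [_]; length; map; allFin)
open import Data.Nat.ListAction using (sum)
open import Data.List.Relation.Unary.Unique.Propositional using (Unique)
open import Data.List.Relation.Unary.Linked using (Linked)
open import Data.Product using (Σ; ∃; ∃₂; _×_; _,_)
open import Data.Sum using (_⊎_)
open import Data.Unit using (⊤)
open import Relation.Nullary using (¬_)
open import Relation.Binary.PropositionalEquality using (_≡_; cong₂)

record SimpleGraph (n : ℕ) : Set where
  field
    adj    : Fin n → Fin n → Bool
    sym    : ∀ x y → adj x y ≡ adj y x
    irrefl : ∀ x → adj x x ≡ false
open SimpleGraph public

Edge : ∀ {n} → SimpleGraph n → Fin n → Fin n → Set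
Edge G x y = adj G x y ≡ true

count : ∀ {n} → (Fin n → Bool) → ℕ
count {n} p = sum (map (λ y → if p y then 1 else 0) (allFin n))

deg : ∀ {n} → SimpleGraph n → Fin n → ℕ
deg G x = count (adj G x)

Subgraph : ∀ {n} → SimpleGraph n → SimpleGraph n → Set
Subgraph {n} H G = ∀ (x y : Fin n) → Edge H x y → Edge G x y

_∪_ : ∀ {n} → SimpleGraph n → SimpleGraph n → SimpleGraph n
S ∪ T = record
  { adj    = λ x y → adj S x y ∨ adj T x y
  ; sym    = λ x y → cong₂ _∨_ (sym S x y) (sym T x y)
  ; irrefl = λ x → cong₂ _∨_ (irrefl S x) (irrefl T x)
  }

data Reachable {n} (G : SimpleGraph n) : Fin n → Fin n → Set where
  here : ∀ {x} → Reachable G x x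
  step : ∀ {x y z} → Edge G x y → Reachable G y z → Reachable G x z

Connected : ∀ {n} → SimpleGraph n → Set
Connected {n} G = ∀ (x y : Fin n) → Reachable G x y

HasCycle : ∀ {n} → SimpleGraph n → Set
HasCycle {n} G = ∃₂ λ (x : Fin n) (xs : List (Fin n)) →
  2 ≤ length xs × Unique (x ∷ xs) × Linked (Edge G) ((x ∷ xs) ++ [ x ])

IsTree : ∀ {n} → SimpleGraph n → Set
IsTree T = Connected T × ¬ HasCycle T

IsSpanningTree : ∀ {n} → SimpleGraph n → SimpleGraph n → Set
IsSpanningTree G T = Subgraph T G × IsTree T

leaves : ∀ {n} → SimpleGraph n → ℕ
leaves T = count (λ x → isOne (deg T x))
  where
  isOne : ℕ → Bool
  isOne 1 = true
  isOne _ = false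

IsLeafNumber : ∀ {n} → SimpleGraph n → ℕ → Set
IsLeafNumber G ℓ =
  (Σ _ λ T → IsSpanningTree G T × leaves T ≡ ℓ) ×
  (∀ T → IsSpanningTree G T → leaves T ≤ ℓ)

IsSk : ∀ {n} → ℕ → SimpleGraph n → SimpleGraph n → Set
IsSk {n} k G S = Subgraph S G × (∀ (x : Fin n) → (deg G x ⊓ k) ≤ deg S x)

expTerm : ℚ → ℕ → ℚ
expTerm q zero    = 1ℚ
expTerm q (suc j) = expTerm q j ℚ.* q ℚ.* (+ 1 / suc j)

expPartial : ℚ → ℕ → ℚ
expPartial q zero    = 0ℚ
expPartial q (suc N) = expPartial q N ℚ.+ expTerm q N

-- LnGe K q  means  ln K ≥ q  (for a natural K ≥ 1):
-- if q ≤ 0 this holds since ln K ≥ 0; if q > 0 it is e^q ≤ K, and e^q is the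
-- supremum of the (increasing) partial sums Σ_{j<N} q^j/j!.
LnGe : ℕ → ℚ → Set
LnGe K q = q ℚ.≤ 0ℚ ⊎ (∀ N → expPartial q N ℚ.≤ (+ K / 1))

-- LeafBound k a b  means  a ≥ (1 - 30·(1 + ln(k+1))/(k+1)) · b.
-- With K = k+1 this is K·a ≥ (K - 30 - 30·ln K)·b, i.e.
-- 30·b·ln K ≥ (K - 30)·b - K·a.  For b = 0 it holds trivially (a ≥ 0);
-- for b > 0 it is ln K ≥ ((K - 30)·b - K·a) / (30·b).
LeafBound : ℕ → ℕ → ℕ → Set
LeafBound k a zero    = ⊤
LeafBound k a (suc b) =
  LnGe (suc k)
       ((((+ suc k) ℤ.- (+ 30)) ℤ.* (+ suc b) ℤ.- (+ suc k) ℤ.* (+ a)) / (30 * suc b))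

{-# OPTIONS --safe #-}
module Submission where

-- Put K = k + 1 and H = S ∪ T, and call x heavy if deg_G x ≥ k.  All edges at light vertices survive in S,
-- and heavy vertices have at least K closed S-neighbours.
--
-- Growing a connected set in G, always preferring vertices within distance two that cover at least six new
-- vertices, yields a set W with |W| ≤ 2 leaf(G) such that every closed neighbourhood has at most five vertices
-- outside W.  Hence a greedy choice of vertices of W, together with the few heavy vertices outside W, gives a
-- set D of O(leaf(G) · H_K / K) vertices (H_K the harmonic number) dominating all heavy vertices in S.
--
-- Let I be the internal vertices of an optimal spanning tree of G.  Then I ∪ D dominates H; an edge of G inside
-- I can only be lost between heavy vertices, which are next to D, so I ∪ D becomes connected in H after adding
-- two vertices per element of D.  The vertices outside the resulting connected dominating set are leaves of
-- a spanning tree of H, so leaf(H) ≥ leaf(G) - 3 |D|.  Finally e^(H_K - 1) ≤ K, i.e. H_K ≤ 1 + ln K.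

open import Defs hiding (sym)
import Defs
import Algebra.Properties.CommutativeMonoid.Sum as Sum
open import Data.Bool as Bool using (Bool; true; false; _∧_; _∨_; not; if_then_else_)
open import Data.Bool.Properties using (∧-zeroʳ; ∨-zeroʳ; ∨-comm; not-injective; ¬-not)
open import Data.Empty using (⊥; ⊥-elim)
open import Data.Fin using (Fin; zero; suc; fromℕ<)
open import Data.Fin.Properties using (_≟_; any?)
open import Data.List using (_∷_; []; _++_; [_]; tabulate)
open import Data.List.Properties using (map-tabulate)
open import Data.List.Relation.Unary.All using (All; []; _∷_)
open import Data.List.Relation.Unary.All.Properties using (All¬⇒¬Any)
open import Data.List.Relation.Unary.AllPairs using ([]; _∷_)
open import Data.List.Relation.Unary.Any using (Any; here; there)
open import Data.List.Relation.Unary.Linked using (Linked; [-]; _∷_)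
open import Data.List.Relation.Unary.Unique.Propositional using (Unique)
open import Data.Nat.ListAction using () renaming (sum to sumᴸ)
open import Data.Product using (Σ; ∃; _×_; _,_; proj₁; proj₂)
open import Data.Sum using (_⊎_; inj₁; inj₂; [_,_]′)
open import Data.Unit using (tt)
open import Function using (_∘_; id)
open import Relation.Nullary using (¬_; Dec; yes; no; does)
open import Relation.Nullary.Decidable using (dec-true)
open import Relation.Binary.PropositionalEquality hiding ([_])

-- Logarithm bounds from harmonic numbers, via partial sums of the exponential series

module Exponential where

  open import Data.Integer as ℤ using (ℤ; +_)
  import Data.Integer.Properties as ℤₚ
  open import Data.Nat as ℕ using (ℕ; zero; suc; _!)
  import Data.Nat.Properties as ℕₚ
  open import Data.Rational
  open import Data.Rational.Properties
  open import Data.Rational.Solver using (module +-*-Solver)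
  open import Data.Rational.Unnormalised as ℚᵘ using (mkℚᵘ; *≡*; *≤*)
  import Data.Rational.Unnormalised.Properties as ℚᵘₚ

  -- harmonic i / (i + 1)! = 1/2 + 1/3 + … + 1/(i + 1)
  harmonic : ℕ → ℕ
  harmonic zero    = 0
  harmonic (suc i) = (2 ℕ.+ i) ℕ.* harmonic i ℕ.+ suc i !

  -- A fraction `a / suc m` is `fromℚᵘ (mkℚᵘ a m)` by definition, so arithmetic of fractions is
  -- checked on unnormalised representatives, away from gcds.
  fromℚᵘ-+ : ∀ p q → fromℚᵘ p + fromℚᵘ q ≡ fromℚᵘ (p ℚᵘ.+ q)
  fromℚᵘ-+ p q = toℚᵘ-injective (ℚᵘₚ.≃-trans (toℚᵘ-homo-+ (fromℚᵘ p) (fromℚᵘ q))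
    (ℚᵘₚ.≃-trans (ℚᵘₚ.+-cong (toℚᵘ-fromℚᵘ p) (toℚᵘ-fromℚᵘ q)) (ℚᵘₚ.≃-sym (toℚᵘ-fromℚᵘ (p ℚᵘ.+ q)))))

  fromℚᵘ-* : ∀ p q → fromℚᵘ p * fromℚᵘ q ≡ fromℚᵘ (p ℚᵘ.* q)
  fromℚᵘ-* p q = toℚᵘ-injective (ℚᵘₚ.≃-trans (toℚᵘ-homo-* (fromℚᵘ p) (fromℚᵘ q))
    (ℚᵘₚ.≃-trans (ℚᵘₚ.*-cong (toℚᵘ-fromℚᵘ p) (toℚᵘ-fromℚᵘ q)) (ℚᵘₚ.≃-sym (toℚᵘ-fromℚᵘ (p ℚᵘ.* q)))))

  fromℚᵘ-mono : ∀ {p q} → p ℚᵘ.≤ q → fromℚᵘ p ≤ fromℚᵘ q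
  fromℚᵘ-mono {p} {q} p≤q = toℚᵘ-cancel-≤ (ℚᵘₚ.≤-trans (ℚᵘₚ.≤-reflexive (toℚᵘ-fromℚᵘ p))
    (ℚᵘₚ.≤-trans p≤q (ℚᵘₚ.≤-reflexive (ℚᵘₚ.≃-sym (toℚᵘ-fromℚᵘ q)))))

  ι : ℤ → ℚ
  ι z = z / 1

  ι-* : ∀ a b → ι a * ι b ≡ ι (a ℤ.* b)
  ι-* a b = fromℚᵘ-* (mkℚᵘ a 0) (mkℚᵘ b 0)

  ι-+ : ∀ a b → ι a + ι b ≡ ι (a ℤ.+ b)
  ι-+ a b = trans (fromℚᵘ-+ (mkℚᵘ a 0) (mkℚᵘ b 0))
    (cong ι (cong₂ ℤ._+_ (ℤₚ.*-identityʳ a) (ℤₚ.*-identityʳ b)))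

  ι-mono : ∀ a b → a ℤ.≤ b → ι a ≤ ι b
  ι-mono a b a≤b = fromℚᵘ-mono {mkℚᵘ a 0} {mkℚᵘ b 0} (*≤* (subst₂ ℤ._≤_ (sym (ℤₚ.*-identityʳ a)) (sym (ℤₚ.*-identityʳ b)) a≤b))

  /-cancel : ∀ a m → (a / suc m) * ι (+ suc m) ≡ ι a
  /-cancel a m = trans (fromℚᵘ-* (mkℚᵘ a m) (mkℚᵘ (+ suc m) 0)) (fromℚᵘ-cong {mkℚᵘ a m ℚᵘ.* mkℚᵘ (+ suc m) 0} {mkℚᵘ a 0} (*≡* eq))
    where
    eq : a ℤ.* + suc m ℤ.* + 1 ≡ a ℤ.* + (suc m ℕ.* 1)
    eq = trans (ℤₚ.*-assoc a (+ suc m) (+ 1)) (cong (a ℤ.*_) (sym (ℤₚ.pos-* (suc m) 1)))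

  ι-suc : ∀ j → ι (+ suc j) ≡ ι (+ j) + 1ℚ
  ι-suc j = trans (cong (λ m → ι (+ m)) (ℕₚ.+-comm 1 j)) (sym (ι-+ (+ j) (+ 1)))

  recip : ∀ j → (+ 1 / suc j) * ι (+ suc j) ≡ 1ℚ
  recip j = /-cancel (+ 1) j

  *-nonneg : ∀ {p q} → 0ℚ ≤ p → 0ℚ ≤ q → 0ℚ ≤ p * q
  *-nonneg {p} {q} 0≤p 0≤q = nonNegative⁻¹ (p * q) {{nonNeg*nonNeg⇒nonNeg p {{nonNegative 0≤p}} q {{nonNegative 0≤q}}}}

  +-nonneg : ∀ {p q} → 0ℚ ≤ p → 0ℚ ≤ q → 0ℚ ≤ p + q
  +-nonneg = +-mono-≤

  *-mono : ∀ {p p′ q q′} → 0ℚ ≤ q → 0ℚ ≤ p′ → p ≤ p′ → q ≤ q′ → p * q ≤ p′ * q′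
  *-mono {p} {p′} {q} {q′} 0≤q 0≤p′ p≤p′ q≤q′ =
    ≤-trans (*-monoʳ-≤-nonNeg q {{nonNegative 0≤q}} p≤p′) (*-monoˡ-≤-nonNeg p′ {{nonNegative 0≤p′}} q≤q′)

  0≤recip : ∀ j → 0ℚ ≤ + 1 / suc j
  0≤recip j = fromℚᵘ-mono {mkℚᵘ (+ 0) 0} {mkℚᵘ (+ 1) j} (*≤* (ℤ.+≤+ ℕ.z≤n))

  expTerm-nonneg : ∀ {q} → 0ℚ ≤ q → ∀ j → 0ℚ ≤ expTerm q j
  expTerm-nonneg 0≤q zero    = ι-mono (+ 0) (+ 1) (ℤ.+≤+ ℕ.z≤n)
  expTerm-nonneg 0≤q (suc j) = *-nonneg (*-nonneg (expTerm-nonneg 0≤q j) 0≤q) (0≤recip j)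

  expTerm-mono : ∀ {p q} → 0ℚ ≤ p → p ≤ q → ∀ j → expTerm p j ≤ expTerm q j
  expTerm-mono 0≤p p≤q zero    = ≤-refl
  expTerm-mono 0≤p p≤q (suc j) = *-monoʳ-≤-nonNeg (+ 1 / suc j) {{nonNegative (0≤recip j)}}
    (*-mono 0≤p (expTerm-nonneg (≤-trans 0≤p p≤q) j) (expTerm-mono 0≤p p≤q j) p≤q)

  expPartial-mono : ∀ {p q} → 0ℚ ≤ p → p ≤ q → ∀ N → expPartial p N ≤ expPartial q N
  expPartial-mono 0≤p p≤q zero    = ≤-refl
  expPartial-mono 0≤p p≤q (suc N) = +-mono-≤ (expPartial-mono 0≤p p≤q N) (expTerm-mono 0≤p p≤q N)

  expTerm-absorb : ∀ q j → expTerm q j * q ≡ ι (+ suc j) * expTerm q (suc j)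
  expTerm-absorb q j = begin
    expTerm q j * q                                     ≡⟨ *-identityʳ _ ⟨
    expTerm q j * q * 1ℚ                                ≡⟨ cong (expTerm q j * q *_) (recip j) ⟨
    expTerm q j * q * ((+ 1 / suc j) * ι (+ suc j))     ≡⟨ *-assoc (expTerm q j * q) _ _ ⟨
    expTerm q (suc j) * ι (+ suc j)                     ≡⟨ *-comm (expTerm q (suc j)) _ ⟩
    ι (+ suc j) * expTerm q (suc j)                     ∎
    where open ≡-Reasoning

  open +-*-Solver using (solve; _:+_; _:*_; _:=_; con)

  -- The mean value estimate (x + t)ʲ - xʲ ≤ j t (x + t)ʲ⁻¹, divided by j!.
  expTerm-diff : ∀ {x t} → 0ℚ ≤ x → 0ℚ ≤ t → ∀ j →
                 expTerm (x + t) (suc j) ≤ expTerm x (suc j) + t * expTerm (x + t) j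
  expTerm-diff {x} {t} 0≤x 0≤t zero = ≤-reflexive
    (solve 2 (λ x t → con 1ℚ :* (x :+ t) :* con 1ℚ := con 1ℚ :* x :* con 1ℚ :+ t :* con 1ℚ) refl x t)
  expTerm-diff {x} {t} 0≤x 0≤t (suc j) = begin
    a₁ * (x + t) * c
      ≡⟨ solve 4 (λ a x t c → a :* (x :+ t) :* c := a :* x :* c :+ a :* t :* c) refl a₁ x t c ⟩
    a₁ * x * c + a₁ * t * c                       ≤⟨ +-monoˡ-≤ (a₁ * t * c) (≤c (≤x (expTerm-diff 0≤x 0≤t j))) ⟩
    (b₁ + t * a₀) * x * c + a₁ * t * c
      ≡⟨ solve 6 (λ a₁ b₁ t a₀ x c → (b₁ :+ t :* a₀) :* x :* c :+ a₁ :* t :* c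
           := b₁ :* x :* c :+ (t :* (a₀ :* x) :+ a₁ :* t) :* c) refl a₁ b₁ t a₀ x c ⟩
    -- Apart from the induction hypothesis the only loss is `x ≤ x + t` here. It turns `a₀ * x` into
    -- `a₀ * (x + t) = (j + 1) a₁`, so that the two terms in `t` add up to `(j + 2) c t a₁ = t a₁`.
    b₁ * x * c + (t * (a₀ * x) + a₁ * t) * c
      ≤⟨ +-monoʳ-≤ (b₁ * x * c) (≤c (+-monoˡ-≤ (a₁ * t) (*-monoˡ-≤-nonNeg t {{nonNegative 0≤t}} (*-monoˡ-≤-nonNeg a₀ {{nonNegative 0≤a₀}} x≤y)))) ⟩
    b₁ * x * c + (t * (a₀ * (x + t)) + a₁ * t) * c
      ≡⟨ cong (λ z → b₁ * x * c + (t * z + a₁ * t) * c) (expTerm-absorb (x + t) j) ⟩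
    b₁ * x * c + (t * (ι (+ suc j) * a₁) + a₁ * t) * c
      ≡⟨ solve 6 (λ a₁ b₁ t m x c → b₁ :* x :* c :+ (t :* (m :* a₁) :+ a₁ :* t) :* c
           := b₁ :* x :* c :+ t :* a₁ :* (c :* (m :+ con 1ℚ))) refl a₁ b₁ t (ι (+ suc j)) x c ⟩
    b₁ * x * c + t * a₁ * (c * (ι (+ suc j) + 1ℚ)) ≡⟨ cong (λ z → b₁ * x * c + t * a₁ * (c * z)) (ι-suc (suc j)) ⟨
    b₁ * x * c + t * a₁ * (c * ι (+ suc (suc j))) ≡⟨ cong (λ z → b₁ * x * c + t * a₁ * z) (recip (suc j)) ⟩
    b₁ * x * c + t * a₁ * 1ℚ                      ≡⟨ cong (λ z → b₁ * x * c + z) (*-identityʳ (t * a₁)) ⟩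
    b₁ * x * c + t * a₁                           ∎
    where
    open ≤-Reasoning
    c = + 1 / suc (suc j)
    a₀ = expTerm (x + t) j
    a₁ = expTerm (x + t) (suc j)
    b₁ = expTerm x (suc j)
    0≤a₀ : 0ℚ ≤ a₀
    0≤a₀ = expTerm-nonneg (+-nonneg 0≤x 0≤t) j
    x≤y : x ≤ x + t
    x≤y = ≤-trans (≤-reflexive (sym (+-identityʳ x))) (+-monoʳ-≤ x 0≤t)
    ≤x : ∀ {p q} → p ≤ q → p * x ≤ q * x
    ≤x = *-monoʳ-≤-nonNeg x {{nonNegative 0≤x}}
    ≤c : ∀ {p q} → p ≤ q → p * c ≤ q * c
    ≤c = *-monoʳ-≤-nonNeg c {{nonNegative (0≤recip (suc j))}}

  expPartial-diff : ∀ {x t} → 0ℚ ≤ x → 0ℚ ≤ t → ∀ N →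
                    expPartial (x + t) (suc N) ≤ expPartial x (suc N) + t * expPartial (x + t) N
  expPartial-diff {x} {t} 0≤x 0≤t zero = ≤-reflexive (sym (trans (cong (λ z → 0ℚ + 1ℚ + z) (*-zeroʳ t)) (+-identityʳ _)))
  expPartial-diff {x} {t} 0≤x 0≤t (suc N) = ≤-trans
    (+-mono-≤ (expPartial-diff 0≤x 0≤t N) (expTerm-diff 0≤x 0≤t N))
    (≤-reflexive (solve 5 (λ a b t e f → (a :+ t :* e) :+ (b :+ t :* f) := (a :+ b) :+ t :* (e :+ f)) refl
      (expPartial x (suc N)) (expTerm x (suc N)) t (expPartial (x + t) N) (expTerm (x + t) N)))

  -- The partial-sum form of `(1 - t) e^(x + t) ≤ e^x`, written without subtraction. Restoring the
  -- term that `expPartial-diff` saves gives the same `N` on both sides, so that `exp-harmonic` can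
  -- cancel.
  expPartial-shift : ∀ {x t} → 0ℚ ≤ x → 0ℚ ≤ t → ∀ N →
                     expPartial (x + t) N ≤ expPartial x N + t * expPartial (x + t) N
  expPartial-shift {x} {t} 0≤x 0≤t zero = ≤-reflexive (sym (trans (+-identityˡ _) (*-zeroʳ t)))
  expPartial-shift {x} {t} 0≤x 0≤t (suc N) = ≤-trans (expPartial-diff 0≤x 0≤t N)
    (+-monoʳ-≤ (expPartial x (suc N)) (*-monoˡ-≤-nonNeg t {{nonNegative 0≤t}}
      (≤-trans (≤-reflexive (sym (+-identityʳ _)))
        (+-monoʳ-≤ (expPartial (x + t) N) (expTerm-nonneg (+-nonneg 0≤x 0≤t) N)))))

  harmonicℚ : ℕ → ℚ
  harmonicℚ zero    = 0ℚ
  harmonicℚ (suc i) = harmonicℚ i + (+ 1 / suc (suc i))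

  harmonicℚ-nonneg : ∀ i → 0ℚ ≤ harmonicℚ i
  harmonicℚ-nonneg zero    = ≤-refl
  harmonicℚ-nonneg (suc i) = +-nonneg (harmonicℚ-nonneg i) (0≤recip (suc i))

  expPartial-0 : ∀ N → expPartial 0ℚ N ≤ 1ℚ
  expPartial-0 zero    = ι-mono (+ 0) (+ 1) (ℤ.+≤+ ℕ.z≤n)
  expPartial-0 (suc N) = ≤-reflexive (go N)
    where
    go : ∀ N → expPartial 0ℚ (suc N) ≡ 1ℚ
    go zero    = refl
    go (suc N) = cong₂ _+_ (go N) (trans (cong (_* (+ 1 / suc N)) (*-zeroʳ (expTerm 0ℚ N))) (*-zeroˡ (+ 1 / suc N)))

  -- The step from i to i + 1 is e^t ≤ 1 / (1 - t) at t = 1 / (i + 2).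
  exp-harmonic : ∀ i N → expPartial (harmonicℚ i) N ≤ ι (+ suc i)
  exp-harmonic zero    N = expPartial-0 N
  exp-harmonic (suc i) N = *-cancelʳ-≤-pos m {{m-pos}} (+-cancelʳ E (begin
    E * m + E                      ≡⟨ solve 2 (λ E m → E :* m :+ E := (m :+ con 1ℚ) :* E) refl E m ⟩
    (m + 1ℚ) * E                   ≡⟨ cong (_* E) (ι-suc (suc i)) ⟨
    m′ * E                         ≤⟨ *-monoˡ-≤-nonNeg m′ {{nonNegative 0≤m′}} shift ⟩
    m′ * (m + t * E)
      ≡⟨ solve 4 (λ m′ m t E → m′ :* (m :+ t :* E) := m′ :* m :+ t :* m′ :* E) refl m′ m t E ⟩
    m′ * m + t * m′ * E            ≡⟨ cong (λ z → m′ * m + z * E) (recip (suc i)) ⟩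
    m′ * m + 1ℚ * E                ≡⟨ cong (λ z → m′ * m + z) (*-identityˡ E) ⟩
    m′ * m + E                     ∎))
    where
    open ≤-Reasoning
    t = + 1 / suc (suc i)
    m = ι (+ suc i)
    m′ = ι (+ suc (suc i))
    E = expPartial (harmonicℚ (suc i)) N
    m-pos : Positive m
    m-pos = normalize-pos (suc i) 1
    0≤m′ : 0ℚ ≤ m′
    0≤m′ = ι-mono (+ 0) (+ suc (suc i)) (ℤ.+≤+ ℕ.z≤n)
    shift : E ≤ m + t * E
    shift = ≤-trans (expPartial-shift (harmonicℚ-nonneg i) (0≤recip (suc i)) N) (+-monoˡ-≤ (t * E) (exp-harmonic i N))
    +-cancelʳ : ∀ {p q} r → p + r ≤ q + r → p ≤ q
    +-cancelʳ {p} {q} r h = subst₂ _≤_ (un p) (un q) (+-monoˡ-≤ (- r) h)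
      where
      un : ∀ p → p + r + - r ≡ p
      un p = trans (+-assoc p r (- r)) (trans (cong (λ z → p + z) (+-inverseʳ r)) (+-identityʳ p))

  harmonicℚ-! : ∀ i → harmonicℚ i * ι (+ (suc i !)) ≡ ι (+ harmonic i)
  harmonicℚ-! zero    = refl
  harmonicℚ-! (suc i) = begin
    (h + t) * ι (+ (suc (suc i) !))                 ≡⟨ cong (λ z → (h + t) * z) split ⟨
    (h + t) * (m * f)
      ≡⟨ solve 4 (λ h t m f → (h :+ t) :* (m :* f) := m :* (h :* f) :+ t :* m :* f) refl h t m f ⟩
    m * (h * f) + t * m * f                         ≡⟨ cong₂ (λ y z → m * y + z * f) (harmonicℚ-! i) (recip (suc i)) ⟩
    m * ι (+ harmonic i) + 1ℚ * f                   ≡⟨ cong₂ _+_ (ι-*ℕ (suc (suc i)) (harmonic i)) (*-identityˡ f) ⟩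
    ι (+ (suc (suc i) ℕ.* harmonic i)) + f          ≡⟨ ι-+ (+ (suc (suc i) ℕ.* harmonic i)) (+ (suc i !)) ⟩
    ι (+ harmonic (suc i))                          ∎
    where
    open ≡-Reasoning
    h = harmonicℚ i
    t = + 1 / suc (suc i)
    m = ι (+ suc (suc i))
    f = ι (+ (suc i !))
    ι-*ℕ : ∀ a b → ι (+ a) * ι (+ b) ≡ ι (+ (a ℕ.* b))
    ι-*ℕ a b = trans (ι-* (+ a) (+ b)) (cong ι (sym (ℤₚ.pos-* a b)))
    split : m * f ≡ ι (+ (suc (suc i) !))
    split = ι-*ℕ (suc (suc i)) (suc i !)

  -- With `H` the harmonic number of `suc i`, the hypothesis says `a / suc m ≤ H - 1`, and
  -- `exp-harmonic` gives `e^(H - 1) ≤ suc i`. The sign of the fraction is split off because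
  -- `expPartial-mono` needs a nonnegative argument.
  lnGe-harmonic : ∀ i (a : ℤ) m → a ℤ.* + (suc i !) ℤ.≤ + harmonic i ℤ.* + suc m → LnGe (suc i) (a / suc m)
  lnGe-harmonic i a m h with ≤-total (a / suc m) 0ℚ
  ... | inj₁ q≤0 = inj₁ q≤0
  ... | inj₂ 0≤q = inj₂ λ N → ≤-trans (expPartial-mono 0≤q q≤h N) (exp-harmonic i N)
    where
    q = a / suc m
    f = ι (+ (suc i !))
    d = ι (+ suc m)
    instance
      f-pos : Positive f
      f-pos = normalize-pos (suc i !) 1 {{_}} {{ℕₚ._!≢0 (suc i)}}
      d-pos : Positive d
      d-pos = normalize-pos (suc m) 1
    q≤h : q ≤ harmonicℚ i
    q≤h = *-cancelʳ-≤-pos d (*-cancelʳ-≤-pos f (begin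
      q * d * f                        ≡⟨ cong (_* f) (/-cancel a m) ⟩
      ι a * f                          ≡⟨ ι-* a (+ (suc i !)) ⟩
      ι (a ℤ.* + (suc i !))            ≤⟨ ι-mono (a ℤ.* + (suc i !)) (+ harmonic i ℤ.* + suc m) h ⟩
      ι (+ harmonic i ℤ.* + suc m)     ≡⟨ ι-* (+ harmonic i) (+ suc m) ⟨
      ι (+ harmonic i) * d             ≡⟨ cong (_* d) (harmonicℚ-! i) ⟨
      harmonicℚ i * f * d              ≡⟨ solve 3 (λ h f d → h :* f :* d := h :* d :* f) refl (harmonicℚ i) f d ⟩
      harmonicℚ i * d * f              ∎))
      where open ≤-Reasoning

open import Data.Nat hiding (_≟_)
open import Data.Nat.Properties hiding (_≟_)
open import Data.Nat.Solver using (module +-*-Solver)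

open Exponential using (harmonic; lnGe-harmonic)
open Sum +-0-commutativeMonoid using (sum; ∑-distrib-+; ∑-comm; sum-cong-≗)
open +-*-Solver using (solve; _:+_; _:*_; _:=_; con)

-- Vertex sets

VSet : ℕ → Set
VSet n = Fin n → Bool

infix 4 _∈_ _∉_ _⊆_
_∈_ _∉_ : ∀ {n} → Fin n → VSet n → Set
x ∈ p = p x ≡ true
x ∉ p = p x ≡ false

_⊆_ : ∀ {n} → VSet n → VSet n → Set
p ⊆ q = ∀ x → x ∈ p → x ∈ q

infixr 6 _∩ˢ_
infixr 5 _∪ˢ_
_∩ˢ_ _∪ˢ_ : ∀ {n} → VSet n → VSet n → VSet n
(p ∩ˢ q) x = p x ∧ q x
(p ∪ˢ q) x = p x ∨ q x

∁ : ∀ {n} → VSet n → VSet n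
∁ p x = not (p x)

⁅_⁆ : ∀ {n} → Fin n → VSet n
⁅ x ⁆ y = does (x ≟ y)

true≢false : ∀ {b} → b ≡ true → b ≡ false → ⊥
true≢false refl ()

∈-dec : ∀ {n} (p : VSet n) x → x ∈ p ⊎ x ∉ p
∈-dec p x with p x
... | true  = inj₁ refl
... | false = inj₂ refl

∧⁻ : ∀ {a b} → a ∧ b ≡ true → a ≡ true × b ≡ true
∧⁻ {true} {true} _ = refl , refl

∧⁺ : ∀ {a b} → a ≡ true → b ≡ true → a ∧ b ≡ true
∧⁺ refl refl = refl

∨⁻ : ∀ {a b} → a ∨ b ≡ true → a ≡ true ⊎ b ≡ true
∨⁻ {true}  _ = inj₁ refl
∨⁻ {false} e = inj₂ e

∨⁺ˡ : ∀ {a b} → a ≡ true → a ∨ b ≡ true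
∨⁺ˡ refl = refl

∨⁺ʳ : ∀ {a b} → b ≡ true → a ∨ b ≡ true
∨⁺ʳ {a} refl = ∨-zeroʳ a

not⁺ : ∀ {b} → b ≡ false → not b ≡ true
not⁺ refl = refl

not⁻ : ∀ {b} → not b ≡ true → b ≡ false
not⁻ = not-injective

∈⁅⁆ : ∀ {n} (x : Fin n) → x ∈ ⁅ x ⁆
∈⁅⁆ x = dec-true (x ≟ x) refl

∈⁅⁆⁻ : ∀ {n} {x y : Fin n} → y ∈ ⁅ x ⁆ → x ≡ y
∈⁅⁆⁻ {x = x} {y} e with x ≟ y
... | yes p = p

does⁻ : ∀ {P : Set} (d : Dec P) → does d ≡ true → P
does⁻ (yes p) _ = p

search : ∀ {n} (p : VSet n) → (∃ λ x → x ∈ p) ⊎ (∀ x → x ∉ p)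
search p with any? (λ x → p x Bool.≟ true)
... | yes w = inj₁ w
... | no ¬w = inj₂ λ x → ¬-not (λ e → ¬w (x , e))

-- Cardinalities

ind : Bool → ℕ
ind b = if b then 1 else 0

-- Replaces the list sum in `count` by a sum over `Fin n`, for which additivity and exchange of
-- summations are available.
count≡sum : ∀ {n} (p : VSet n) → count p ≡ sum (ind ∘ p)
count≡sum p = trans (cong sumᴸ (map-tabulate id (ind ∘ p))) (go (ind ∘ p))
  where
  go : ∀ {n} (f : Fin n → ℕ) → sumᴸ (tabulate f) ≡ sum f
  go {zero}  f = refl
  go {suc n} f = cong (f zero +_) (go (f ∘ suc))

sum-mono : ∀ {n} {f g : Fin n → ℕ} → (∀ x → f x ≤ g x) → sum f ≤ sum g
sum-mono {zero}  h = z≤n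
sum-mono {suc n} h = +-mono-≤ (h zero) (sum-mono (h ∘ suc))

sum-* : ∀ {n} c (f : Fin n → ℕ) → c * sum f ≡ sum (λ x → c * f x)
sum-* {zero}  c f = *-zeroʳ c
sum-* {suc n} c f = trans (*-distribˡ-+ c (f zero) _) (cong (c * f zero +_) (sum-* c (f ∘ suc)))

ind-mono : ∀ {a b} → (a ≡ true → b ≡ true) → ind a ≤ ind b
ind-mono {false} h = z≤n
ind-mono {true}  h rewrite h refl = ≤-refl

count-mono : ∀ {n} (p q : VSet n) → p ⊆ q → count p ≤ count q
count-mono p q h rewrite count≡sum p | count≡sum q = sum-mono λ x → ind-mono (h x)

count-cong : ∀ {n} {p q : VSet n} → (∀ x → p x ≡ q x) → count p ≡ count q
count-cong {p = p} {q} h rewrite count≡sum p | count≡sum q = sum-cong-≗ (cong ind ∘ h)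

count-∪ : ∀ {n} (p q : VSet n) → count (p ∪ˢ q) ≤ count p + count q
count-∪ p q rewrite count≡sum p | count≡sum q | count≡sum (p ∪ˢ q)
                  | sym (∑-distrib-+ (ind ∘ p) (ind ∘ q)) = sum-mono λ x → go (p x) (q x)
  where
  go : ∀ a b → ind (a ∨ b) ≤ ind a + ind b
  go true  b = m≤m+n 1 (ind b)
  go false b = ≤-refl

count-split : ∀ {n} (p q : VSet n) → count (p ∩ˢ q) + count (p ∩ˢ ∁ q) ≡ count p
count-split p q rewrite count≡sum p | count≡sum (p ∩ˢ q) | count≡sum (p ∩ˢ ∁ q)
                      | sym (∑-distrib-+ (ind ∘ (p ∩ˢ q)) (ind ∘ (p ∩ˢ ∁ q))) = sum-cong-≗ λ x → go (p x) (q x)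
  where
  go : ∀ a b → ind (a ∧ b) + ind (a ∧ not b) ≡ ind a
  go true  true  = refl
  go true  false = refl
  go false b     = refl

count-all : ∀ {n} {p : VSet n} → (∀ x → x ∈ p) → count p ≡ n
count-all {n} {p} h rewrite count≡sum p = go n (ind ∘ p) (cong ind ∘ h)
  where
  go : ∀ n (f : Fin n → ℕ) → (∀ x → f x ≡ 1) → sum f ≡ n
  go zero    f h = refl
  go (suc n) f h = cong₂ _+_ (h zero) (go n (f ∘ suc) (h ∘ suc))

count-∁ : ∀ {n} (p : VSet n) → count p + count (∁ p) ≡ n
count-∁ p = trans (count-split (λ _ → true) p) (count-all λ _ → refl)

count≤n : ∀ {n} (p : VSet n) → count p ≤ n
count≤n p = ≤-trans (m≤m+n (count p) (count (∁ p))) (≤-reflexive (count-∁ p))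

count-∅ : ∀ {n} {p : VSet n} → (∀ x → x ∉ p) → count p ≡ 0
count-∅ {n} {p} h = +-cancelʳ-≡ n (count p) 0
  (trans (cong (count p +_) (sym (count-all λ x → cong not (h x)))) (count-∁ p))

count-⁅⁆ : ∀ {n} (x : Fin n) → count ⁅ x ⁆ ≡ 1
count-⁅⁆ x = trans (count≡sum ⁅ x ⁆) (go x)
  where
  go : ∀ {n} (x : Fin n) → sum (ind ∘ ⁅ x ⁆) ≡ 1
  go {suc n} zero = cong suc (trans (sym (count≡sum {n} λ _ → false)) (count-∅ {n} λ _ → refl))
  go (suc x)      = go x

count-< : ∀ {n} {p q : VSet n} {x} → p ⊆ q → x ∈ q → x ∉ p → suc (count p) ≤ count q
count-< {p = p} {q} {x} p⊆q x∈q x∉p = begin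
  1 + count p                      ≡⟨ cong (_+ count p) (sym (count-⁅⁆ x)) ⟩
  count ⁅ x ⁆ + count p            ≤⟨ +-mono-≤ (count-mono ⁅ x ⁆ (q ∩ˢ ∁ p) λ y y∈ → single (∈⁅⁆⁻ y∈))
                                              (count-mono p (q ∩ˢ p) λ y y∈p → ∧⁺ (p⊆q y y∈p) y∈p) ⟩
  count (q ∩ˢ ∁ p) + count (q ∩ˢ p) ≡⟨ +-comm (count (q ∩ˢ ∁ p)) _ ⟩
  count (q ∩ˢ p) + count (q ∩ˢ ∁ p) ≡⟨ count-split q p ⟩
  count q                          ∎
  where
  open ≤-Reasoning
  single : ∀ {y} → x ≡ y → y ∈ q ∩ˢ ∁ p
  single refl = ∧⁺ x∈q (not⁺ x∉p)

count-full : ∀ {n} {p q : VSet n} → p ⊆ q → count q ≤ count p → q ⊆ p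
count-full {p = p} p⊆q q≤p x x∈q with ∈-dec p x
... | inj₁ x∈p = x∈p
... | inj₂ x∉p = ⊥-elim (<⇒≱ (count-< p⊆q x∈q x∉p) q≤p)

count-pos : ∀ {n} {p : VSet n} → 1 ≤ count p → ∃ λ x → x ∈ p
count-pos {p = p} 1≤ with search p
... | inj₁ w = w
... | inj₂ h rewrite count-∅ {p = p} h with () ← 1≤

count-unique : ∀ {n} {p : VSet n} {x y} → count p ≡ 1 → x ∈ p → y ∈ p → x ≡ y
count-unique {p = p} {x} {y} c x∈p y∈p = ∈⁅⁆⁻ (count-full {p = ⁅ x ⁆} {q = p}
  (λ z z∈ → subst (_∈ p) (∈⁅⁆⁻ z∈) x∈p) (≤-reflexive (trans c (sym (count-⁅⁆ x)))) y y∈p)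

count-∩-insert : ∀ {n} {p p′ q : VSet n} {y} → (∀ z → z ∈ p′ → z ≡ y ⊎ z ∈ p) →
            count (p′ ∩ˢ q) ≤ 1 + count (p ∩ˢ q)
count-∩-insert {p = p} {p′} {q} {y} h = ≤-trans (count-mono (p′ ∩ˢ q) (⁅ y ⁆ ∪ˢ p ∩ˢ q) go)
  (≤-trans (count-∪ ⁅ y ⁆ (p ∩ˢ q)) (≤-reflexive (cong (_+ count (p ∩ˢ q)) (count-⁅⁆ y))))
  where
  go : p′ ∩ˢ q ⊆ ⁅ y ⁆ ∪ˢ p ∩ˢ q
  go z z∈ with ∧⁻ {p′ z} z∈
  ... | z∈p′ , z∈q with h z z∈p′
  ...   | inj₁ refl = ∨⁺ˡ (∈⁅⁆ y)
  ...   | inj₂ z∈p  = ∨⁺ʳ {⁅ y ⁆ z} (∧⁺ z∈p z∈q)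

-- Both sides bound the number of pairs `(x , y)` with `x ∈ U`, `y ∈ W` and `R y x`, summed once by
-- `x` and once by `y`.
double-count : ∀ {n} (R : Fin n → Fin n → Bool) (U W : VSet n) (d j : ℕ) →
               (∀ x → x ∈ U → d ≤ count (λ y → W y ∧ R y x)) →
               (∀ y → y ∈ W → count (λ x → U x ∧ R y x) ≤ j) →
               d * count U ≤ j * count W
double-count {n} R U W d j lower upper = begin
  d * count U                                    ≡⟨ cong (d *_) (count≡sum U) ⟩
  d * sum (ind ∘ U)                              ≡⟨ sum-* d (ind ∘ U) ⟩
  sum (λ x → d * ind (U x))                      ≤⟨ sum-mono lower′ ⟩
  sum (λ x → sum (λ y → ind (U x ∧ (W y ∧ R y x)))) ≡⟨ ∑-comm {n} {n} (λ x y → ind (U x ∧ (W y ∧ R y x))) ⟩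
  sum (λ y → sum (λ x → ind (U x ∧ (W y ∧ R y x)))) ≤⟨ sum-mono upper′ ⟩
  sum (λ y → j * ind (W y))                      ≡⟨ sum-* j (ind ∘ W) ⟨
  j * sum (ind ∘ W)                              ≡⟨ cong (j *_) (count≡sum W) ⟨
  j * count W                                    ∎
  where
  open ≤-Reasoning
  lower′ : ∀ x → d * ind (U x) ≤ sum (λ y → ind (U x ∧ (W y ∧ R y x)))
  lower′ x with U x | lower x
  ... | false | _ rewrite *-zeroʳ d = z≤n
  ... | true  | h rewrite *-identityʳ d | sym (count≡sum (λ y → W y ∧ R y x)) = h refl
  upper′ : ∀ y → sum (λ x → ind (U x ∧ (W y ∧ R y x))) ≤ j * ind (W y)
  upper′ y with W y | upper y
  ... | false | _ rewrite sym (count≡sum (λ x → U x ∧ false))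
                        | count-∅ {p = λ x → U x ∧ false} (λ x → ∧-zeroʳ (U x)) = z≤n
  ... | true  | h rewrite *-identityʳ j | sym (count≡sum (λ x → U x ∧ R y x)) = h refl

-- Closed neighbourhoods, walks and reachability

N[_] : ∀ {n} → SimpleGraph n → Fin n → VSet n
N[ G ] x = ⁅ x ⁆ ∪ˢ adj G x

edge-sym : ∀ {n} (G : SimpleGraph n) {x y} → Edge G x y → Edge G y x
edge-sym G {x} {y} = trans (Defs.sym G y x)

N-refl : ∀ {n} (G : SimpleGraph n) x → x ∈ N[ G ] x
N-refl G x = ∨⁺ˡ (∈⁅⁆ x)

N-edge : ∀ {n} (G : SimpleGraph n) {x y} → Edge G x y → y ∈ N[ G ] x
N-edge G {x} {y} = ∨⁺ʳ {⁅ x ⁆ y}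

N⁻ : ∀ {n} (G : SimpleGraph n) {x y} → y ∈ N[ G ] x → x ≡ y ⊎ Edge G x y
N⁻ G {x} {y} h with ∨⁻ {⁅ x ⁆ y} h
... | inj₁ e = inj₁ (∈⁅⁆⁻ e)
... | inj₂ e = inj₂ e

N-sym : ∀ {n} (G : SimpleGraph n) {x y} → y ∈ N[ G ] x → x ∈ N[ G ] y
N-sym G h with N⁻ G h
... | inj₁ refl = h
... | inj₂ e    = N-edge G (edge-sym G e)

N-mono : ∀ {n} {H G : SimpleGraph n} → Subgraph H G → ∀ x → N[ H ] x ⊆ N[ G ] x
N-mono {H = H} {G} sub x y h with N⁻ H h
... | inj₁ refl = N-refl G x
... | inj₂ e    = N-edge G (sub x y e)

reach-trans : ∀ {n} {G : SimpleGraph n} {x y z} → Reachable G x y → Reachable G y z → Reachable G x z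
reach-trans Reachable.here       q = q
reach-trans (Reachable.step e p) q = Reachable.step e (reach-trans p q)

reach-sym : ∀ {n} {G : SimpleGraph n} {x y} → Reachable G x y → Reachable G y x
reach-sym         Reachable.here       = Reachable.here
reach-sym {G = G} (Reachable.step e p) =
  reach-trans (reach-sym p) (Reachable.step (edge-sym G e) Reachable.here)

crossing-edge : ∀ {n} {G : SimpleGraph n} (C : VSet n) {x y} → Reachable G x y → x ∈ C → y ∉ C →
                ∃ λ u → ∃ λ v → u ∈ C × v ∉ C × Edge G u v
crossing-edge C Reachable.here x∈ x∉ = ⊥-elim (true≢false x∈ x∉)
crossing-edge C (Reachable.step {x} {y} e p) x∈ z∉ with ∈-dec C y
... | inj₁ y∈ = crossing-edge C p y∈ z∉
... | inj₂ y∉ = x , y , x∈ , y∉ , e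

-- Spanning trees from parent functions

module ParentTree {n} (H : SimpleGraph n) (r : Fin n) (par : Fin n → Fin n) (rank : Fin n → ℕ)
  (par-edge : ∀ x → x ≢ r → Edge H x (par x)) (par-rank : ∀ x → x ≢ r → rank (par x) < rank x) where

  Up : Fin n → Fin n → Set
  Up x y = x ≢ r × par x ≡ y

  up : Fin n → Fin n → Bool
  up x y = not (⁅ r ⁆ x) ∧ ⁅ par x ⁆ y

  up⁻ : ∀ {x y} → up x y ≡ true → Up x y
  up⁻ {x} {y} h with ∧⁻ {not (⁅ r ⁆ x)} h
  ... | a , b = (λ { refl → true≢false (∈⁅⁆ r) (not⁻ a) }) , ∈⁅⁆⁻ b

  up⁺ : ∀ {x y} → Up x y → up x y ≡ true
  up⁺ {x} (x≢r , refl) = ∧⁺ (not⁺ (¬-not λ e → x≢r (sym (∈⁅⁆⁻ e)))) (∈⁅⁆ (par x))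

  Up-rank : ∀ {x y} → Up x y → rank y < rank x
  Up-rank {x} (x≢r , refl) = par-rank x x≢r

  tree : SimpleGraph n
  tree = record
    { adj    = λ x y → up x y ∨ up y x
    ; sym    = λ x y → ∨-comm (up x y) (up y x)
    ; irrefl = λ x → ¬-not λ h → <-irrefl refl (Up-rank (up⁻ ([ id , id ]′ (∨⁻ {up x x} h))))
    }

  edge⁻ : ∀ {x y} → Edge tree x y → Up x y ⊎ Up y x
  edge⁻ {x} {y} h with ∨⁻ {up x y} h
  ... | inj₁ u = inj₁ (up⁻ u)
  ... | inj₂ u = inj₂ (up⁻ u)

  tree-sub : Subgraph tree H
  tree-sub x y e with edge⁻ e
  ... | inj₁ (x≢r , refl) = par-edge x x≢r
  ... | inj₂ (y≢r , refl) = edge-sym H (par-edge y y≢r)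

  to-root : ∀ m x → rank x < m → Reachable tree x r
  to-root (suc m) x (s≤s rx≤m) with x ≟ r
  ... | yes refl = Reachable.here
  ... | no x≢r   = Reachable.step (∨⁺ˡ (up⁺ (x≢r , refl)))
                     (to-root m (par x) (<-≤-trans (par-rank x x≢r) rx≤m))

  tree-connected : Connected tree
  tree-connected x y = reach-trans (to-root _ x ≤-refl) (reach-sym (to-root _ y ≤-refl))

  -- A path that once moves away from the root keeps doing so, as the only way back is the vertex it came from.
  descend : ∀ {a c e} rest → Up c a → Unique (a ∷ c ∷ rest) → All (e ≢_) (a ∷ c ∷ rest) →
            Linked (Edge tree) (c ∷ rest ++ [ e ]) →
            rank c < rank e × ∃ λ l → Up e l × Any (l ≡_) (c ∷ rest)
  descend [] u _ (e≢a ∷ _) (ce ∷ [-]) with edge⁻ ce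
  ... | inj₁ (_ , p) = ⊥-elim (e≢a (trans (sym p) (proj₂ u)))
  ... | inj₂ v       = Up-rank v , _ , v , here refl
  descend (d ∷ rest) u ((_ ∷ a≢d ∷ _) ∷ uniq) (_ ∷ e≢) (cd ∷ link) with edge⁻ cd
  ... | inj₁ (_ , p) = ⊥-elim (a≢d (trans (sym (proj₂ u)) p))
  ... | inj₂ v with descend rest v uniq e≢ link
  ...   | lt , l , w , l∈ = <-trans (Up-rank v) lt , l , w , there l∈

  -- A path climbs towards the root up to some turn and descends afterwards. Without a turn the rank
  -- falls all the way to `e`; after a turn, `descend` shows that `e` is entered from its parent.
  ascend : ∀ {c e} rest → Unique (c ∷ rest) → All (e ≢_) (c ∷ rest) →
           Linked (Edge tree) (c ∷ rest ++ [ e ]) →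
           rank e < rank c ⊎ (∃ λ l → Up e l × Any (l ≡_) (c ∷ rest))
  ascend [] _ _ (ce ∷ [-]) with edge⁻ ce
  ... | inj₁ u = inj₁ (Up-rank u)
  ... | inj₂ v = inj₂ (_ , v , here refl)
  ascend (d ∷ rest) uniq@(_ ∷ uniq′) e≢@(_ ∷ e≢′) (cd ∷ link) with edge⁻ cd
  ... | inj₂ v with descend rest v uniq e≢ link
  ...   | _ , l , w , l∈ = inj₂ (l , w , there l∈)
  ascend (d ∷ rest) uniq@(_ ∷ uniq′) e≢@(_ ∷ e≢′) (cd ∷ link) | inj₁ u with ascend rest uniq′ e≢′ link
  ... | inj₁ lt           = inj₁ (<-trans lt (Up-rank u))
  ... | inj₂ (l , w , l∈) = inj₂ (l , w , there l∈)

  -- If `y` is a child of `x`, climbing back at once would give `z ≡ x`, and otherwise the ranks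
  -- grow all the way round. If `y` is the parent of `x`, either the ranks fall all the way round or
  -- the cycle re-enters `x` from its parent, visiting `y` twice.
  tree-acyclic : ¬ HasCycle tree
  tree-acyclic (x , []         , ()     , _)
  tree-acyclic (x , (y ∷ [])   , s≤s () , _)
  tree-acyclic (x , (y ∷ z ∷ zs) , _ , x≢@(_ ∷ x≢z ∷ _) ∷ uniq@(y≢ ∷ uniq′) , xy ∷ yz ∷ link)
    with edge⁻ xy | edge⁻ yz
  ... | inj₂ v | inj₁ (_ , p) = x≢z (trans (sym (proj₂ v)) p)
  ... | inj₂ v | inj₂ w =
    <-asym (<-trans (Up-rank v) (Up-rank w)) (proj₁ (descend zs w uniq x≢ link))
  ... | inj₁ (_ , refl) | inj₂ w with descend zs w uniq x≢ link
  ...   | _ , l , (_ , refl) , l∈ = All¬⇒¬Any y≢ l∈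
  tree-acyclic (x , (y ∷ z ∷ zs) , _ , (_ ∷ x≢) ∷ uniq@(y≢ ∷ uniq′) , xy ∷ yz ∷ link)
      | inj₁ u@(_ , refl) | inj₁ w with ascend zs uniq′ x≢ link
  ...   | inj₁ lt                     = <-asym lt (<-trans (Up-rank w) (Up-rank u))
  ...   | inj₂ (l , (_ , refl) , l∈) = All¬⇒¬Any y≢ l∈

  tree-spanning : IsSpanningTree H tree
  tree-spanning = tree-sub , tree-connected , tree-acyclic

  childless-deg : ∀ x → x ≢ r → (∀ y → y ≢ r → par y ≢ x) → deg tree x ≡ 1
  childless-deg x x≢r childless = trans (≤-antisym
      (count-mono (adj tree x) ⁅ par x ⁆ fwd) (count-mono ⁅ par x ⁆ (adj tree x) bwd)) (count-⁅⁆ (par x))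
    where
    fwd : adj tree x ⊆ ⁅ par x ⁆
    fwd y e with edge⁻ e
    ... | inj₁ (_ , refl) = ∈⁅⁆ (par x)
    ... | inj₂ (y≢r , p)  = ⊥-elim (childless y y≢r p)
    bwd : ⁅ par x ⁆ ⊆ adj tree x
    bwd y e = ∨⁺ˡ (up⁺ (x≢r , ∈⁅⁆⁻ e))

-- The test used by `leaves` is local to its definition, so it is recovered by unification.
leafSet : ∀ {n} (T : SimpleGraph n) → ∃ λ (L : VSet n) → leaves T ≡ count L
leafSet T = _ , refl

leaf-test : ∀ {n} (T : SimpleGraph n) x → proj₁ (leafSet T) x ≡ (deg T x ≡ᵇ 1)
leaf-test T x with deg T x
... | 0           = refl
... | 1           = refl
... | suc (suc _) = refl

leaves≡count : ∀ {n} (T : SimpleGraph n) → leaves T ≡ count (λ x → deg T x ≡ᵇ 1)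
leaves≡count T = trans (proj₂ (leafSet T)) (count-cong (leaf-test T))

leaves-≥ : ∀ {n} (T : SimpleGraph n) (q : VSet n) → (∀ x → x ∈ q → deg T x ≡ 1) → count q ≤ leaves T
leaves-≥ T q h rewrite leaves≡count T = count-mono q _ λ x x∈q → cong (_≡ᵇ 1) (h x x∈q)

-- Connected sets grown vertex by vertex

-- A vertex set inducing a connected subgraph, stored as the history of its construction: parents
-- and ranks are read off by recursion on it.
data Grown {n} (H : SimpleGraph n) (r : Fin n) : VSet n → Set where
  start : Grown H r ⁅ r ⁆
  grow  : ∀ {X x y} → Grown H r X → x ∈ X → y ∉ X → Edge H x y → Grown H r (⁅ y ⁆ ∪ˢ X)

root∈ : ∀ {n} {H : SimpleGraph n} {r X} → Grown H r X → r ∈ X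
root∈ {r = r} start = ∈⁅⁆ r
root∈ {r = r} (grow {y = y} g _ _ _) = ∨⁺ʳ {⁅ y ⁆ r} (root∈ g)

Dominates : ∀ {n} → SimpleGraph n → VSet n → Set
Dominates H X = ∀ y → ∃ λ x → x ∈ X × y ∈ N[ H ] x

record Parents {n} (H : SimpleGraph n) (r : Fin n) (X : VSet n) : Set where
  field
    par      : Fin n → Fin n
    rank     : Fin n → ℕ
    par∈     : ∀ x → x ∈ X → x ≢ r → par x ∈ X
    par-edge : ∀ x → x ∈ X → x ≢ r → Edge H x (par x)
    par-rank : ∀ x → x ∈ X → x ≢ r → rank (par x) < rank x

parents : ∀ {n} {H : SimpleGraph n} {r X} → Grown H r X → Parents H r X
parents {r = r} start = record
  { par = id ; rank = λ _ → 0
  ; par∈     = λ x x∈ _ → x∈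
  ; par-edge = λ x x∈ x≢r → ⊥-elim (x≢r (sym (∈⁅⁆⁻ x∈)))
  ; par-rank = λ x x∈ x≢r → ⊥-elim (x≢r (sym (∈⁅⁆⁻ x∈)))
  }
parents {n} {H} {r} (grow {X} {x} {y} g x∈ y∉ xy) = record
  { par = par′ ; rank = rank′
  ; par∈     = λ z z∈ z≢r → proj₁ (ok z z∈ z≢r)
  ; par-edge = λ z z∈ z≢r → proj₁ (proj₂ (ok z z∈ z≢r))
  ; par-rank = λ z z∈ z≢r → proj₂ (proj₂ (ok z z∈ z≢r))
  }
  where
  open Parents (parents g)
  par′ : Fin n → Fin n
  par′ z = if ⁅ y ⁆ z then x else par z
  rank′ : Fin n → ℕ
  rank′ z = if ⁅ y ⁆ z then suc (rank x) else rank z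
  old : ∀ {z} → z ∈ X → ⁅ y ⁆ z ≡ false
  old z∈ = ¬-not λ e → true≢false z∈ (subst (_∉ X) (∈⁅⁆⁻ e) y∉)
  rank-old : ∀ {z} → z ∈ X → rank′ z ≡ rank z
  rank-old z∈ rewrite old z∈ = refl
  ok : ∀ z → z ∈ ⁅ y ⁆ ∪ˢ X → z ≢ r →
       par′ z ∈ ⁅ y ⁆ ∪ˢ X × Edge H z (par′ z) × rank′ (par′ z) < rank′ z
  ok z z∈ z≢r with ⁅ y ⁆ z in eq
  ... | true  rewrite rank-old x∈ | sym (∈⁅⁆⁻ {x = y} {z} eq) = ∨⁺ʳ {⁅ y ⁆ x} x∈ , edge-sym H xy , ≤-refl
  ... | false rewrite rank-old (par∈ z z∈ z≢r) =
    ∨⁺ʳ {⁅ y ⁆ (par z)} (par∈ z z∈ z≢r) , par-edge z z∈ z≢r , par-rank z z∈ z≢r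

-- Every vertex outside `X` is hung from a dominator in `X`. It then has no children, so it is a
-- leaf.
cds-tree : ∀ {n} {H : SimpleGraph n} {r X} → Grown H r X → Dominates H X →
           ∃ λ T → IsSpanningTree H T × count (∁ X) ≤ leaves T
cds-tree {n} {H} {r} {X} g dom = tree , tree-spanning , leaves-≥ tree (∁ X) λ x x∈ →
    let x∉X = not⁻ x∈ in
    childless-deg x (λ { refl → true≢false (root∈ g) x∉X })
      λ y y≢r p → true≢false (proj₁ (ok y y≢r)) (subst (_∉ X) (sym p) x∉X)
  where
  open Parents (parents g)
  par′ : Fin n → Fin n
  par′ x = if X x then par x else proj₁ (dom x)
  rank′ : Fin n → ℕ
  rank′ x = if X x then rank x else suc (rank (proj₁ (dom x)))
  rank-in : ∀ {x} → x ∈ X → rank′ x ≡ rank x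
  rank-in x∈ rewrite x∈ = refl
  ok : ∀ x → x ≢ r → par′ x ∈ X × Edge H x (par′ x) × rank′ (par′ x) < rank′ x
  ok x x≢r with X x in eq
  ... | true  rewrite rank-in (par∈ x eq x≢r) = par∈ x eq x≢r , par-edge x eq x≢r , par-rank x eq x≢r
  ... | false with dom x
  ...   | y , y∈ , x∈N rewrite rank-in y∈ with N⁻ H x∈N
  ...     | inj₁ refl = ⊥-elim (true≢false y∈ eq)
  ...     | inj₂ yx   = y∈ , edge-sym H yx , ≤-refl
  open ParentTree H r par′ rank′ (λ x x≢r → proj₁ (proj₂ (ok x x≢r))) (λ x x≢r → proj₂ (proj₂ (ok x x≢r)))

N⟨_⟩ : ∀ {n} → SimpleGraph n → VSet n → VSet n
N⟨ H ⟩ X y = does (any? λ u → (X u ∧ N[ H ] u y) Bool.≟ true)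

N⟨⟩⁺ : ∀ {n} (H : SimpleGraph n) (X : VSet n) {u y} → u ∈ X → y ∈ N[ H ] u → y ∈ N⟨ H ⟩ X
N⟨⟩⁺ H X {u} u∈ y∈ = dec-true (any? _) (u , ∧⁺ u∈ y∈)

N⟨⟩⁻ : ∀ {n} (H : SimpleGraph n) (X : VSet n) {y} → y ∈ N⟨ H ⟩ X → ∃ λ u → u ∈ X × y ∈ N[ H ] u
N⟨⟩⁻ H X {y} h with any? (λ u → (X u ∧ N[ H ] u y) Bool.≟ true)
... | yes (u , e) = u , ∧⁻ e

-- `A` limits which vertices may be new: `_≡ y` when one vertex is attached, `_∈ I` when a whole
-- walk is. As `y` may already belong to `X`, sizes are only bounded from above.
record Extension {n} (H : SimpleGraph n) (r : Fin n) (X : VSet n) (y : Fin n) (A : Fin n → Set) : Set where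
  field
    {set} : VSet n
    grown : Grown H r set
    ⊇old  : X ⊆ set
    new∈  : y ∈ set
    only  : ∀ z → z ∈ set → A z ⊎ z ∈ X
open Extension

attach : ∀ {n} {H : SimpleGraph n} {r X u} y → Grown H r X → u ∈ X → y ∈ N[ H ] u →
         Extension H r X y (_≡ y)
attach {H = H} {X = X} {u} y g u∈ y∈N with ∈-dec X y
... | inj₁ y∈ = record { grown = g ; ⊇old = λ _ → id ; new∈ = y∈ ; only = λ _ → inj₂ }
... | inj₂ y∉ = record
  { grown = grow g u∈ y∉ uy
  ; ⊇old  = λ z → ∨⁺ʳ {⁅ y ⁆ z}
  ; new∈  = ∨⁺ˡ (∈⁅⁆ y)
  ; only  = λ z z∈ → [ inj₁ ∘ sym ∘ ∈⁅⁆⁻ , inj₂ ]′ (∨⁻ {⁅ y ⁆ z} z∈)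
  }
  where
  uy : Edge H u y
  uy with N⁻ H y∈N
  ... | inj₁ refl = ⊥-elim (true≢false u∈ y∉)
  ... | inj₂ e    = e

attach-count : ∀ {n} {H : SimpleGraph n} {r X y} (e : Extension H r X y (_≡ y)) →
               count (set e) ≤ 1 + count X
attach-count {X = X} {y} e = ≤-trans
  (count-mono (set e) (⁅ y ⁆ ∪ˢ X) λ z z∈ →
     [ (λ { refl → ∨⁺ˡ (∈⁅⁆ y) }) , ∨⁺ʳ {⁅ y ⁆ z} ]′ (only e z z∈))
  (≤-trans (count-∪ ⁅ y ⁆ X) (≤-reflexive (cong (_+ count X) (count-⁅⁆ y))))

-- A small set absorbing almost every closed neighbourhood

module Absorb {n} (G : SimpleGraph n) (conn : Connected G) (r : Fin n) (1≤deg : 1 ≤ deg G r) where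

  missed : VSet n → Fin n → ℕ
  missed W x = count (N[ G ] x ∩ˢ ∁ W)

  -- W collects the vertices covered in bulk.  A single vertex w is added to C without entering W only when every
  -- closed neighbourhood containing w has at most five vertices outside C; this is why `absorbs` is maintained.
  record State : Set where
    field
      {X C W} : VSet n
      grown   : Grown G r X
      r∈C     : r ∈ C
      covered : ∀ z → z ∈ C → ∃ λ u → u ∈ X × z ∈ N[ G ] u
      weight  : count W + 2 * count X ≤ 2 * count C
      absorbs : ∀ x → N[ G ] x ∩ˢ C ⊆ W ⊎ missed W x ≤ 5
  open State

  initial : State
  initial = record
    { X = ⁅ r ⁆ ; C = N[ G ] r ; W = N[ G ] r
    ; grown   = start
    ; r∈C     = N-refl G r
    ; covered = λ z z∈ → r , ∈⁅⁆ r , z∈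
    ; weight  = weight₀
    ; absorbs = λ x → inj₁ λ z z∈ → proj₂ (∧⁻ {N[ G ] x z} z∈)
    }
    where
    -- With `W = C = N[ G ] r` and `|X| = 1` the weight invariant asks for `|N[ G ] r| ≥ 2`; this is
    -- what `1≤deg` provides.
    2≤ : 2 ≤ count (N[ G ] r)
    2≤ with count-pos {p = adj G r} 1≤deg
    ... | y , e = subst (λ c → suc c ≤ count (N[ G ] r)) (count-⁅⁆ r)
      (count-< {p = ⁅ r ⁆} {q = N[ G ] r} {y} (λ z → ∨⁺ˡ) (N-edge G e)
        (¬-not λ y∈ → true≢false e (subst (λ z → adj G r z ≡ false) (∈⁅⁆⁻ y∈) (irrefl G r))))
    weight₀ : count (N[ G ] r) + 2 * count ⁅ r ⁆ ≤ 2 * count (N[ G ] r)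
    weight₀ rewrite count-⁅⁆ r | +-identityʳ (count (N[ G ] r)) = +-monoʳ-≤ (count (N[ G ] r)) 2≤

  count-grows : ∀ (C A : VSet n) → count C + count (A ∩ˢ ∁ C) ≤ count (C ∪ˢ A)
  count-grows C A = begin
    count C + count (A ∩ˢ ∁ C)
      ≤⟨ +-mono-≤ (count-mono C ((C ∪ˢ A) ∩ˢ C) λ z z∈ → ∧⁺ (∨⁺ˡ z∈) z∈)
                  (count-mono (A ∩ˢ ∁ C) ((C ∪ˢ A) ∩ˢ ∁ C) λ z z∈ →
                     ∧⁺ (∨⁺ʳ {C z} (proj₁ (∧⁻ {A z} z∈))) (proj₂ (∧⁻ {A z} z∈))) ⟩
    count ((C ∪ˢ A) ∩ˢ C) + count ((C ∪ˢ A) ∩ˢ ∁ C) ≡⟨ count-split (C ∪ˢ A) C ⟩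
    count (C ∪ˢ A) ∎
    where open ≤-Reasoning

  -- Attaching `v`, `w`, `x` raises `2 |X|` by at most 6, `W` gains at most the `m` newly covered
  -- vertices, and `C` gains these `m`. The weight survives since `m + 6 ≤ 2 m`: hence the threshold
  -- six.
  good : (s : State) (v w x : Fin n) → v ∈ C s → w ∈ N[ G ] v → x ∈ N[ G ] w → 6 ≤ missed (C s) x →
         Σ State λ s′ → suc (count (C s)) ≤ count (C s′)
  good s v w x v∈C w∈Nv x∈Nw 6≤m with covered s v v∈C
  ... | u , u∈X , v∈Nu = s′ , ≤-trans (+-monoˡ-≤ (count (C s)) {1} (≤-trans (s≤s z≤n) 6≤m))
                            (≤-trans (≤-reflexive (+-comm m (count (C s)))) (count-grows (C s) (N[ G ] x)))
    where
    m = missed (C s) x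
    e₁ = attach v (grown s) u∈X v∈Nu
    e₂ = attach w (Extension.grown e₁) (new∈ e₁) w∈Nv
    e₃ = attach x (Extension.grown e₂) (new∈ e₂) x∈Nw
    C′ = C s ∪ˢ N[ G ] x
    W′ = W s ∪ˢ N[ G ] x ∩ˢ ∁ (C s)
    ΔX : count (set e₃) ≤ 3 + count (X s)
    ΔX = ≤-trans (attach-count e₃) (s≤s (≤-trans (attach-count e₂) (s≤s (attach-count e₁))))
    weight′ : count W′ + 2 * count (set e₃) ≤ 2 * count C′
    weight′ = begin
      count W′ + 2 * count (set e₃)             ≤⟨ +-mono-≤ (count-∪ (W s) _) (*-monoʳ-≤ 2 ΔX) ⟩
      (count (W s) + m) + 2 * (3 + count (X s))
        ≡⟨ solve 3 (λ w m x → (w :+ m) :+ con 2 :* (con 3 :+ x)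
             := (w :+ con 2 :* x) :+ (m :+ con 6)) refl (count (W s)) m (count (X s)) ⟩
      (count (W s) + 2 * count (X s)) + (m + 6) ≤⟨ +-mono-≤ (weight s) (+-monoʳ-≤ m 6≤m) ⟩
      2 * count (C s) + (m + m)
        ≡⟨ solve 2 (λ c m → con 2 :* c :+ (m :+ m) := con 2 :* (c :+ m)) refl (count (C s)) m ⟩
      2 * (count (C s) + m)                     ≤⟨ *-monoʳ-≤ 2 (count-grows (C s) (N[ G ] x)) ⟩
      2 * count C′                              ∎
      where open ≤-Reasoning
    covered′ : ∀ z → z ∈ C′ → ∃ λ u → u ∈ set e₃ × z ∈ N[ G ] u
    covered′ z z∈ with ∨⁻ {C s z} z∈
    ... | inj₂ z∈N = x , new∈ e₃ , z∈N
    ... | inj₁ z∈C with covered s z z∈C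
    ...   | u′ , u′∈ , z∈N = u′ , ⊇old e₃ u′ (⊇old e₂ u′ (⊇old e₁ u′ u′∈)) , z∈N
    absorbs′ : ∀ y → N[ G ] y ∩ˢ C′ ⊆ W′ ⊎ missed W′ y ≤ 5
    absorbs′ y with absorbs s y
    ... | inj₂ le = inj₂ (≤-trans (count-mono (N[ G ] y ∩ˢ ∁ W′) (N[ G ] y ∩ˢ ∁ (W s)) λ z z∈ →
                      let a , b = ∧⁻ {N[ G ] y z} z∈ in
                      ∧⁺ a (not⁺ (¬-not λ z∈W → true≢false (∨⁺ˡ {W s z} z∈W) (not⁻ b)))) le)
    ... | inj₁ h = inj₁ λ z z∈ → go z (∧⁻ {N[ G ] y z} z∈)
      where
      go : ∀ z → z ∈ N[ G ] y × z ∈ C′ → z ∈ W′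
      go z (z∈N , z∈C′) with ∈-dec (C s) z
      ... | inj₁ z∈C = ∨⁺ˡ (h z (∧⁺ z∈N z∈C))
      ... | inj₂ z∉C = ∨⁺ʳ {W s z} (∧⁺
              ([ (λ z∈C → ⊥-elim (true≢false z∈C z∉C)) , id ]′ (∨⁻ {C s z} z∈C′)) (not⁺ z∉C))
    s′ : State
    s′ = record
      { X = set e₃ ; C = C′ ; W = W′ ; grown = Extension.grown e₃
      ; r∈C = ∨⁺ˡ (r∈C s) ; covered = covered′ ; weight = weight′ ; absorbs = absorbs′ }

  -- Only `v` joins `X`; the increase of `2 |X|` by at most 2 is paid by the single new vertex of
  -- `C`, with nothing left over for `W`.
  bad : (s : State) (v w : Fin n) → v ∈ C s → w ∉ C s → w ∈ N[ G ] v →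
        (∀ x → x ∈ N[ G ] w → missed (C s) x ≤ 5) →
        Σ State λ s′ → suc (count (C s)) ≤ count (C s′)
  bad s v w v∈C w∉C w∈Nv stable with covered s v v∈C
  ... | u , u∈X , v∈Nu = s′ , C<C′
    where
    e = attach v (grown s) u∈X v∈Nu
    C′ = ⁅ w ⁆ ∪ˢ C s
    C<C′ : suc (count (C s)) ≤ count C′
    C<C′ = count-< {p = C s} {q = C′} {w} (λ z → ∨⁺ʳ {⁅ w ⁆ z}) (∨⁺ˡ (∈⁅⁆ w)) w∉C
    weight′ : count (W s) + 2 * count (set e) ≤ 2 * count C′
    weight′ = begin
      count (W s) + 2 * count (set e)       ≤⟨ +-monoʳ-≤ (count (W s)) (*-monoʳ-≤ 2 (attach-count e)) ⟩
      count (W s) + 2 * (1 + count (X s))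
        ≡⟨ solve 2 (λ w x → w :+ con 2 :* (con 1 :+ x) := (w :+ con 2 :* x) :+ con 2) refl (count (W s)) (count (X s)) ⟩
      (count (W s) + 2 * count (X s)) + 2   ≤⟨ +-monoˡ-≤ 2 (weight s) ⟩
      2 * count (C s) + 2
        ≡⟨ solve 1 (λ c → con 2 :* c :+ con 2 := con 2 :* (con 1 :+ c)) refl (count (C s)) ⟩
      2 * suc (count (C s))                 ≤⟨ *-monoʳ-≤ 2 C<C′ ⟩
      2 * count C′                          ∎
      where open ≤-Reasoning
    covered′ : ∀ z → z ∈ C′ → ∃ λ u → u ∈ set e × z ∈ N[ G ] u
    covered′ z z∈ with ∨⁻ {⁅ w ⁆ z} z∈
    ... | inj₁ z∈w = v , new∈ e , subst (_∈ N[ G ] v) (∈⁅⁆⁻ z∈w) w∈Nv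
    ... | inj₂ z∈C with covered s z z∈C
    ...   | u′ , u′∈ , z∈N = u′ , ⊇old e u′ u′∈ , z∈N
    absorbs′ : ∀ y → N[ G ] y ∩ˢ C′ ⊆ W s ⊎ missed (W s) y ≤ 5
    absorbs′ y with absorbs s y
    ... | inj₂ le = inj₂ le
    ... | inj₁ h with ∈-dec (N[ G ] y) w
    -- As `N[ G ] y ∩ˢ C s ⊆ W s`, a vertex of `N[ G ] y` outside `W` is also outside `C`, and
    -- `stable` allows at most five of these. The bound persists because `W` never shrinks.
    ...   | inj₁ w∈N = inj₂ (≤-trans (count-mono (N[ G ] y ∩ˢ ∁ (W s)) (N[ G ] y ∩ˢ ∁ (C s)) λ z z∈ →
                      let a , b = ∧⁻ {N[ G ] y z} z∈ in
                      ∧⁺ a (not⁺ (¬-not λ z∈C → true≢false (h z (∧⁺ a z∈C)) (not⁻ b))))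
                      (stable y (N-sym G w∈N)))
    ...   | inj₂ w∉N = inj₁ λ z z∈ → go z (∧⁻ {N[ G ] y z} z∈)
      where
      go : ∀ z → z ∈ N[ G ] y × z ∈ C′ → z ∈ W s
      go z (z∈N , z∈C′) with ∨⁻ {⁅ w ⁆ z} z∈C′
      ... | inj₁ z∈w = ⊥-elim (true≢false z∈N (subst (_∉ N[ G ] y) (∈⁅⁆⁻ z∈w) w∉N))
      ... | inj₂ z∈C = h z (∧⁺ z∈N z∈C)
    s′ : State
    s′ = record
      { X = set e ; C = C′ ; W = W s ; grown = Extension.grown e
      ; r∈C = ∨⁺ʳ {⁅ w ⁆ r} (r∈C s) ; covered = covered′ ; weight = weight′ ; absorbs = absorbs′ }

  -- A failed search shows that every vertex within distance two of `C` has at most five uncovered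
  -- closed neighbours. For an uncovered `w` next to `C` this includes all of `N[ G ] w`, as `bad`
  -- requires.
  advance : (s : State) → ∀ z → z ∉ C s → Σ State λ s′ → suc (count (C s)) ≤ count (C s′)
  advance s z z∉C with search (λ x → N⟨ G ⟩ (N⟨ G ⟩ (C s)) x ∧ does (6 ≤? missed (C s) x))
  ... | inj₁ (x , x∈) =
    let x∈NN , big   = ∧⁻ {N⟨ G ⟩ (N⟨ G ⟩ (C s)) x} x∈
        w , w∈ , x∈w = N⟨⟩⁻ G (N⟨ G ⟩ (C s)) x∈NN
        v , v∈ , w∈v = N⟨⟩⁻ G (C s) w∈
    in good s v w x v∈ w∈v x∈w (does⁻ (6 ≤? missed (C s) x) big)
  ... | inj₂ none =
    let v , w , v∈ , w∉ , vw = crossing-edge (C s) (conn r z) (r∈C s) z∉C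
        w∈v = N-edge G vw
    in bad s v w v∈ w∉ w∈v λ x x∈w → ≤-pred (≰⇒> λ 6≤ → true≢false
         (∧⁺ (N⟨⟩⁺ G (N⟨ G ⟩ (C s)) (N⟨⟩⁺ G (C s) v∈ w∈v) x∈w) (dec-true (6 ≤? missed (C s) x) 6≤)) (none x))

  saturate : ∀ fuel (s : State) → n ≤ fuel + count (C s) → Σ State λ s′ → ∀ z → z ∈ C s′
  saturate fuel s bound with search (∁ (C s))
  saturate fuel s bound | inj₂ none = s , λ z → ¬-not λ z∉ → true≢false (not⁺ z∉) (none z)
  saturate zero s bound | inj₁ (z , z∈) =
    ⊥-elim (<⇒≱ (count-< {p = C s} {q = λ _ → true} {z} (λ _ _ → refl) refl (not⁻ z∈))
      (≤-trans (≤-reflexive (count-all λ _ → refl)) bound))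
  saturate (suc fuel) s bound | inj₁ (z , z∈) with advance s z (not⁻ z∈)
  ... | s′ , lt = saturate fuel s′ (≤-trans bound
      (≤-trans (≤-reflexive (sym (+-suc fuel (count (C s))))) (+-monoʳ-≤ fuel lt)))

  -- Once `C` is everything, the weight invariant reads `|W| ≤ 2 (n - |X|)`. Moreover `X` is then a
  -- connected dominating set, so `cds-tree` gives `n - |X| ≤ b`.
  absorbing-set : ∀ b → (∀ T → IsSpanningTree G T → leaves T ≤ b) →
                  ∃ λ W → count W ≤ 2 * b × (∀ x → missed W x ≤ 5)
  absorbing-set b maxb with saturate n initial (m≤m+n n _)
  ... | s , full = W s , size , few
    where
    ∁X≤b : count (∁ (X s)) ≤ b
    ∁X≤b with cds-tree (grown s) (λ y → covered s y (full y))
    ... | T , span , le = ≤-trans le (maxb T span)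
    size : count (W s) ≤ 2 * b
    size = +-cancelʳ-≤ (2 * count (X s)) (count (W s)) (2 * b) (begin
      count (W s) + 2 * count (X s)                ≤⟨ weight s ⟩
      2 * count (C s)                              ≡⟨ cong (2 *_) (trans (count-all full) (sym (count-∁ (X s)))) ⟩
      2 * (count (X s) + count (∁ (X s)))          ≤⟨ *-monoʳ-≤ 2 (+-monoʳ-≤ (count (X s)) ∁X≤b) ⟩
      2 * (count (X s) + b)
        ≡⟨ solve 2 (λ x b → con 2 :* (x :+ b) := con 2 :* b :+ con 2 :* x) refl (count (X s)) b ⟩
      2 * b + 2 * count (X s)                      ∎)
      where open ≤-Reasoning
    few : ∀ x → missed (W s) x ≤ 5
    few x with absorbs s x
    ... | inj₂ le = le
    ... | inj₁ h  = ≤-trans (≤-reflexive (count-∅ λ z → ¬-not λ z∈ →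
                      let a , b = ∧⁻ {N[ G ] x z} z∈ in true≢false (h z (∧⁺ a (full z))) (not⁻ b))) z≤n

-- Connecting a dominating set in a sparser graph

data Walk {n} (G : SimpleGraph n) (I : VSet n) : Fin n → Fin n → Set where
  stop : ∀ {x} → x ∈ I → Walk G I x x
  step : ∀ {x y z} → x ∈ I → Edge G x y → Walk G I y z → Walk G I x z

module Join {n} (G H : SimpleGraph n) (connH : Connected H) (I D heavy : VSet n)
  (kept  : ∀ x y → Edge G x y → x ∉ heavy → Edge H x y)
  (I-dom : ∀ q → q ∉ heavy → ∃ λ y → y ∈ I × y ∈ N[ H ] q)
  (D-dom : ∀ q → q ∈ heavy → ∃ λ d → d ∈ D × d ∈ N[ H ] q)
  (r : Fin n) (r∈I : r ∈ I) (walks : ∀ y → y ∈ I → Walk G I y r) where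

  -- The walk in `G` is followed up to a heavy vertex: the edges before it start at light vertices
  -- and survive in `H`. The dominator of the heavy vertex in `D` either lies in `X` or is new to
  -- it. If nothing stops the walk, it arrives at `r ∈ X`.
  route : ∀ {X y} → r ∈ X → Walk G I y r →
          (∃ λ z → ∃ λ u → Walk H I y z × u ∈ X × z ∈ N[ H ] u) ⊎
          (∃ λ z → ∃ λ d → Walk H I y z × d ∈ D × d ∉ X × d ∈ N[ H ] z)
  route r∈X (stop r∈I) = inj₁ (r , r , stop r∈I , r∈X , N-refl H r)
  route {X} r∈X (step {y} {y′} y∈I e w) with ∈-dec heavy y
  ... | inj₂ light with route r∈X w
  ...   | inj₁ (z , u , w′ , rest) = inj₁ (z , u , step y∈I (kept y y′ e light) w′ , rest)
  ...   | inj₂ (z , d , w′ , rest) = inj₂ (z , d , step y∈I (kept y y′ e light) w′ , rest)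
  route {X} r∈X (step {y} {y′} y∈I e w) | inj₁ y∈h with D-dom y y∈h
  ... | d , d∈D , d∈N with ∈-dec X d
  ...   | inj₁ d∈X = inj₁ (y , d , stop y∈I , d∈X , N-sym H d∈N)
  ...   | inj₂ d∉X = inj₂ (y , d , stop y∈I , d∈D , d∉X , d∈N)

  absorb-new : ∀ {X X′ : VSet n} {y} → y ∈ I → (∀ z → z ∈ X′ → z ∈ I ⊎ z ∈ X) →
            (e : ∃ λ (Y : VSet n) → ∀ z → z ∈ Y → z ≡ y ⊎ z ∈ X′) → ∀ z → z ∈ proj₁ e → z ∈ I ⊎ z ∈ X
  absorb-new y∈I o (Y , o′) z z∈ with o′ z z∈
  ... | inj₁ refl = inj₁ y∈I
  ... | inj₂ z∈X′ = o z z∈X′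

  -- All new vertices lie in `I`, so a walk adds nothing to the left side of `State.cost`. Here its
  -- end `z` touches `X` and the walk is added from there; in `extend-forth` its start `y` does.
  extend-back : ∀ {X y z u} → Grown H r X → Walk H I y z → u ∈ X → z ∈ N[ H ] u →
                Extension H r X y (_∈ I)
  extend-back {y = y} g (stop y∈I) u∈ y∈N = record
    { grown = Extension.grown a ; ⊇old = ⊇old a ; new∈ = new∈ a
    ; only = absorb-new y∈I (λ _ → inj₂) (_ , only a) }
    where a = attach y g u∈ y∈N
  extend-back {y = y} g (step y∈I e w) u∈ z∈N = record
    { grown = Extension.grown a ; ⊇old = λ z z∈ → ⊇old a z (⊇old b z z∈) ; new∈ = new∈ a
    ; only = absorb-new y∈I (only b) (_ , only a) }
    where
    b = extend-back g w u∈ z∈N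
    a = attach y (Extension.grown b) (new∈ b) (N-edge H (edge-sym H e))

  extend-forth : ∀ {X y z u} → Grown H r X → Walk H I y z → u ∈ X → y ∈ N[ H ] u →
                 Extension H r X z (_∈ I)
  extend-forth {y = y} g (stop y∈I) u∈ y∈N = extend-back g (stop y∈I) u∈ y∈N
  extend-forth {y = y} g (step y∈I e w) u∈ y∈N = record
    { grown = Extension.grown b ; ⊇old = λ z z∈ → ⊇old b z (⊇old a z z∈) ; new∈ = new∈ b
    ; only = λ z z∈ → [ inj₁ , absorb-new y∈I (λ _ → inj₂) (_ , only a) z ]′ (only b z z∈) }
    where
    a = attach y g u∈ y∈N
    b = extend-forth (Extension.grown a) w (new∈ a) (N-edge H e)

  -- Each detour leaving I adds two connecting vertices and a new element of D, whence the factor 3.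
  record State : Set where
    constructor state
    field
      {X}   : VSet n
      grown : Grown H r X
      cost  : count (X ∩ˢ ∁ I) ≤ 3 * count (X ∩ˢ D)
  open State

  finish : ∀ (s : State) {Y z d} → Grown H r Y → X s ⊆ Y → count (Y ∩ˢ ∁ I) ≤ 2 + count (X s ∩ˢ ∁ I) →
           z ∈ Y → d ∈ N[ H ] z → d ∈ D → d ∉ X s → Σ State λ s′ → suc (count (X s)) ≤ count (X s′)
  finish s {Y} {z} {d} g X⊆Y le z∈Y d∈N d∈D d∉X = state (Extension.grown a) cost′ ,
      count-< {p = X s} {q = set a} X⊆ (new∈ a) d∉X
    where
    a = attach d g z∈Y d∈N
    X⊆ : X s ⊆ set a
    X⊆ v v∈ = ⊇old a v (X⊆Y v v∈)
    cost′ : count (set a ∩ˢ ∁ I) ≤ 3 * count (set a ∩ˢ D)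
    cost′ = begin
      count (set a ∩ˢ ∁ I)          ≤⟨ count-∩-insert {p = Y} {set a} {∁ I} {d} (only a) ⟩
      1 + count (Y ∩ˢ ∁ I)          ≤⟨ s≤s le ⟩
      3 + count (X s ∩ˢ ∁ I)        ≤⟨ +-monoʳ-≤ 3 (cost s) ⟩
      3 + 3 * count (X s ∩ˢ D)      ≡⟨ *-suc 3 (count (X s ∩ˢ D)) ⟨
      3 * suc (count (X s ∩ˢ D))    ≤⟨ *-monoʳ-≤ 3 (count-< {p = X s ∩ˢ D} {q = set a ∩ˢ D} {d}
          (λ v v∈ → let p , q = ∧⁻ {X s v} v∈ in ∧⁺ (X⊆ v p) q) (∧⁺ (new∈ a) d∈D)
          (¬-not λ e → true≢false (proj₁ (∧⁻ {X s d} e)) d∉X)) ⟩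
      3 * count (set a ∩ˢ D)        ∎
      where open ≤-Reasoning

  -- No closed neighbour of the undominated `q` lies in `X`. For heavy `q`, attaching `p` and `q`
  -- leads to a new dominator in `D`. A light `q` has a closed neighbour `y` in `I`: if the route
  -- from `y` meets `X`, it is added for free; otherwise `X` grows along `p`, `q` and the route to a
  -- new `d`.
  advance : (s : State) → ∀ {p q u} → u ∈ X s → p ∈ N[ H ] u → q ∉ N⟨ H ⟩ (X s) → Edge H p q →
            Σ State λ s′ → suc (count (X s)) ≤ count (X s′)
  advance s {p} {q} {u} u∈ p∈N q∉ pq with ∈-dec heavy q
  ... | inj₁ q∈h with D-dom q q∈h
  ...   | d , d∈D , d∈N = finish s (Extension.grown b) X⊆ two (new∈ b) d∈N d∈D
      (¬-not λ d∈X → true≢false (N⟨⟩⁺ H (X s) d∈X (N-sym H d∈N)) q∉)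
    where
    a = attach p (grown s) u∈ p∈N
    b = attach q (Extension.grown a) (new∈ a) (N-edge H pq)
    X⊆ : X s ⊆ set b
    X⊆ v v∈ = ⊇old b v (⊇old a v v∈)
    two : count (set b ∩ˢ ∁ I) ≤ 2 + count (X s ∩ˢ ∁ I)
    two = ≤-trans (count-∩-insert {p = set a} {q = ∁ I} (only b)) (s≤s (count-∩-insert {p = X s} {q = ∁ I} (only a)))
  advance s {p} {q} {u} u∈ p∈N q∉ pq | inj₂ light with I-dom q light
  ... | y , y∈I , y∈N with route (root∈ (grown s)) (walks y y∈I)
  ...   | inj₁ (z , u′ , w , u′∈ , z∈N) = state (Extension.grown b) cost′ ,
          count-< {p = X s} {q = set b} (⊇old b) (new∈ b)
            (¬-not λ y∈X → true≢false (N⟨⟩⁺ H (X s) y∈X (N-sym H y∈N)) q∉)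
    where
    b = extend-back (grown s) w u′∈ z∈N
    cost′ : count (set b ∩ˢ ∁ I) ≤ 3 * count (set b ∩ˢ D)
    cost′ = ≤-trans (count-mono (set b ∩ˢ ∁ I) (X s ∩ˢ ∁ I) λ v v∈ →
        let k , l = ∧⁻ {set b v} v∈ in
        ∧⁺ ([ (λ v∈I → ⊥-elim (true≢false v∈I (not⁻ l))) , id ]′ (only b v k)) l)
      (≤-trans (cost s) (*-monoʳ-≤ 3 (count-mono (X s ∩ˢ D) (set b ∩ˢ D) λ v v∈ →
        let k , l = ∧⁻ {X s v} v∈ in ∧⁺ (⊇old b v k) l)))
  ...   | inj₂ (z , d , w , d∈D , d∉X , d∈N) = finish s (Extension.grown c) X⊆ two (new∈ c) d∈N d∈D d∉X
    where
    a = attach p (grown s) u∈ p∈N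
    b = attach q (Extension.grown a) (new∈ a) (N-edge H pq)
    c = extend-forth (Extension.grown b) w (new∈ b) y∈N
    X⊆ : X s ⊆ set c
    X⊆ v v∈ = ⊇old c v (⊇old b v (⊇old a v v∈))
    two : count (set c ∩ˢ ∁ I) ≤ 2 + count (X s ∩ˢ ∁ I)
    two = ≤-trans (count-mono (set c ∩ˢ ∁ I) (set b ∩ˢ ∁ I) λ v v∈ →
        let k , l = ∧⁻ {set c v} v∈ in
        ∧⁺ ([ (λ v∈I → ⊥-elim (true≢false v∈I (not⁻ l))) , id ]′ (only c v k)) l)
      (≤-trans (count-∩-insert {p = set a} {q = ∁ I} (only b)) (s≤s (count-∩-insert {p = X s} {q = ∁ I} (only a))))

  saturate : ∀ fuel (s : State) → n ≤ fuel + count (X s) → Σ State λ s′ → Dominates H (X s′)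
  saturate fuel s bound with search (∁ (N⟨ H ⟩ (X s)))
  saturate fuel s bound | inj₂ none =
    s , λ z → N⟨⟩⁻ H (X s) (¬-not λ z∉ → true≢false (not⁺ z∉) (none z))
  saturate fuel s bound | inj₁ (z , z∈)
    with crossing-edge (N⟨ H ⟩ (X s)) (connH r z)
           (N⟨⟩⁺ H (X s) (root∈ (grown s)) (N-refl H r)) (not⁻ z∈)
  ... | p , q , p∈ , q∉ , pq with N⟨⟩⁻ H (X s) p∈
  ...   | u , u∈ , p∈N with fuel | advance s u∈ p∈N q∉ pq
  ...     | zero | s′ , lt = ⊥-elim (<⇒≱ lt (≤-trans (count≤n (X s′)) bound))
  ...     | suc f | s′ , lt = saturate f s′ (≤-trans bound
      (≤-trans (≤-reflexive (sym (+-suc f (count (X s))))) (+-monoʳ-≤ f lt)))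

  join : ∃ λ X → Grown H r X × Dominates H X × count X ≤ count I + 3 * count D
  join with saturate n (state start cost₀) (m≤m+n n _)
    where
    cost₀ : count (⁅ r ⁆ ∩ˢ ∁ I) ≤ 3 * count (⁅ r ⁆ ∩ˢ D)
    cost₀ = ≤-trans (≤-reflexive (count-∅ λ z → ¬-not λ z∈ →
      let a , b = ∧⁻ {⁅ r ⁆ z} z∈ in true≢false r∈I (subst (_∉ I) (sym (∈⁅⁆⁻ a)) (not⁻ b)))) z≤n
  ... | s , dom = X s , grown s , dom , (begin
    count (X s)                              ≡⟨ count-split (X s) I ⟨
    count (X s ∩ˢ I) + count (X s ∩ˢ ∁ I)
      ≤⟨ +-mono-≤ (count-mono (X s ∩ˢ I) I λ z z∈ → proj₂ (∧⁻ {X s z} z∈)) (cost s) ⟩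
    count I + 3 * count (X s ∩ˢ D)
      ≤⟨ +-monoʳ-≤ (count I) (*-monoʳ-≤ 3 (count-mono (X s ∩ˢ D) D λ z z∈ → proj₂ (∧⁻ {X s z} z∈))) ⟩
    count I + 3 * count D                    ∎)
    where open ≤-Reasoning

-- Greedy domination of the heavy vertices

module Greedy {n} (R : Fin n → Fin n → Bool) (W : VSet n) (d : ℕ) (1≤d : 1 ≤ d) where

  Covers : VSet n → VSet n → Set
  Covers D U = ∀ x → x ∈ U → ∃ λ y → y ∈ D × R y x ≡ true

  record Phase (j : ℕ) (U : VSet n) : Set where
    field
      {D U′}  : VSet n
      U′⊆U    : U′ ⊆ U
      covered : ∀ x → x ∈ U → x ∈ U′ ⊎ ∃ λ y → y ∈ D × R y x ≡ true
      small   : ∀ y → y ∈ W → count (U′ ∩ˢ R y) ≤ j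
      cost    : suc j * count D + count U′ ≤ count U
  open Phase

  -- Takes vertices of `W` as long as one covers more than `j` of the remaining elements; each pick
  -- pays for itself in `cost` by removing at least `suc j` of them.
  phase : ∀ j fuel (U : VSet n) → count U ≤ fuel → Phase j U
  phase j fuel U bound with search (λ y → W y ∧ does (suc j ≤? count (U ∩ˢ R y)))
  phase j fuel U bound | inj₂ none = record
    { D = λ _ → false ; U′ = U ; U′⊆U = λ _ → id ; covered = λ _ → inj₁
    ; small = λ y y∈W → ≤-pred (≰⇒> λ big → true≢false
        (∧⁺ y∈W (dec-true (suc j ≤? count (U ∩ˢ R y)) big)) (none y))
    ; cost = ≤-reflexive (cong (_+ count U) (trans (cong (suc j *_) (count-∅ {n} λ _ → refl)) (*-zeroʳ j)))
    }
  phase j fuel U bound | inj₁ (y , y∈)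
    with does⁻ (suc j ≤? count (U ∩ˢ R y)) (proj₂ (∧⁻ {W y} y∈))
  phase j zero U bound | inj₁ (y , y∈) | big = ⊥-elim (<⇒≱ (≤-trans (s≤s z≤n) big)
    (≤-trans (count-mono (U ∩ˢ R y) U λ x x∈ → proj₁ (∧⁻ {U x} x∈)) bound))
  phase j (suc fuel) U bound | inj₁ (y , y∈) | big = record
    { D = ⁅ y ⁆ ∪ˢ D rec ; U′ = U′ rec
    ; U′⊆U = λ x x∈ → proj₁ (∧⁻ {U x} (U′⊆U rec x x∈))
    ; covered = covered′ ; small = small rec ; cost = cost′ }
    where
    U₁ = U ∩ˢ ∁ (R y)
    shrink : suc j + count U₁ ≤ count U
    shrink = ≤-trans (+-monoˡ-≤ (count U₁) big) (≤-reflexive (count-split U (R y)))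
    rec = phase j fuel U₁ (≤-pred (≤-trans (s≤s (m≤n+m (count U₁) j)) (≤-trans shrink bound)))
    covered′ : ∀ x → x ∈ U → x ∈ U′ rec ⊎ ∃ λ z → z ∈ ⁅ y ⁆ ∪ˢ D rec × R z x ≡ true
    covered′ x x∈U with ∈-dec (R y) x
    ... | inj₁ yx = inj₂ (y , ∨⁺ˡ (∈⁅⁆ y) , yx)
    ... | inj₂ ¬yx with covered rec x (∧⁺ x∈U (not⁺ ¬yx))
    ...   | inj₁ x∈U′          = inj₁ x∈U′
    ...   | inj₂ (z , z∈ , zx) = inj₂ (z , ∨⁺ʳ {⁅ y ⁆ z} z∈ , zx)
    cost′ : suc j * count (⁅ y ⁆ ∪ˢ D rec) + count (U′ rec) ≤ count U
    cost′ = begin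
      suc j * count (⁅ y ⁆ ∪ˢ D rec) + count (U′ rec)
        ≤⟨ +-monoˡ-≤ (count (U′ rec)) (*-monoʳ-≤ (suc j) (count-∪ ⁅ y ⁆ (D rec))) ⟩
      suc j * (count ⁅ y ⁆ + count (D rec)) + count (U′ rec)
        ≡⟨ cong (λ c → suc j * (c + count (D rec)) + count (U′ rec)) (count-⁅⁆ y) ⟩
      suc j * (1 + count (D rec)) + count (U′ rec)
        ≡⟨ solve 3 (λ j c u → j :* (con 1 :+ c) :+ u
             := j :+ (j :* c :+ u)) refl (suc j) (count (D rec)) (count (U′ rec)) ⟩
      suc j + (suc j * count (D rec) + count (U′ rec))
        ≤⟨ +-monoʳ-≤ (suc j) (cost rec) ⟩
      suc j + count U₁ ≤⟨ shrink ⟩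
      count U ∎
      where open ≤-Reasoning

  -- Divided by `suc i ! * d` the bound is `|D| ≤ |U| / (i + 1) + (|W| / d) (1/2 + … + 1/(i +
  -- 1))`. Phases with thresholds `i, …, 0` are run in turn. Double counting bounds the set `U′`
  -- left by phase `suc i` by `(i + 1) |W| / d`, so its extra price
  -- `|U′| / (i + 1) - |U′| / (i + 2)` is at most `|W| / (d (i + 2))`, the next harmonic term.
  greedy : ∀ i (U : VSet n) → (∀ x → x ∈ U → d ≤ count (λ y → W y ∧ R y x)) →
           ∃ λ D → Covers D U × suc i ! * d * count D ≤ d * count U * i ! + count W * harmonic i
  greedy zero U many with phase 0 (count U) U ≤-refl
  ... | ph = D ph , cov , bound
    where
    -- After phase 0 no vertex of `W` covers anything in `U′`, yet each element of `U′` is covered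
    -- at least `d ≥ 1` times.
    empty : count (U′ ph) ≡ 0
    empty = n≤0⇒n≡0 (≤-trans (≤-trans (≤-reflexive (sym (*-identityˡ _))) (*-monoˡ-≤ (count (U′ ph)) 1≤d))
      (double-count R (U′ ph) W d 0 (λ x x∈ → many x (U′⊆U ph x x∈)) (small ph)))
    cov : Covers (D ph) U
    cov x x∈ with covered ph x x∈
    ... | inj₂ w = w
    ... | inj₁ x∈U′ with () ← ≤-trans (count-< {p = λ _ → false} {q = U′ ph} {x} (λ _ ()) x∈U′ refl) (≤-reflexive empty)
    bound : 1 ! * d * count (D ph) ≤ d * count U * 0 ! + count W * 0
    bound = begin
      1 * d * count (D ph)                ≡⟨ cong (_* count (D ph)) (*-identityˡ d) ⟩
      d * count (D ph)
        ≤⟨ *-monoʳ-≤ d (≤-trans (≤-reflexive (sym (*-identityˡ _))) (m+n≤o⇒m≤o _ (cost ph))) ⟩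
      d * count U                         ≡⟨ *-identityʳ _ ⟨
      d * count U * 1                     ≤⟨ m≤m+n _ _ ⟩
      d * count U * 1 + count W * 0       ∎
      where open ≤-Reasoning
  greedy (suc i) U many with phase (suc i) (count U) U ≤-refl
  ... | ph with greedy i (U′ ph) (λ x x∈ → many x (U′⊆U ph x x∈))
  ...   | D₁ , cov₁ , bound₁ = D ph ∪ˢ D₁ , cov , bound
    where
    p = count (D ph)
    c = count D₁
    u = count U
    u′ = count (U′ ph)
    N = count W
    h = harmonic i
    sparse : d * u′ ≤ suc i * N
    sparse = double-count R (U′ ph) W d (suc i) (λ x x∈ → many x (U′⊆U ph x x∈)) (small ph)
    cov : Covers (D ph ∪ˢ D₁) U
    cov x x∈ with covered ph x x∈
    ... | inj₂ (y , y∈ , yx) = y , ∨⁺ˡ y∈ , yx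
    ... | inj₁ x∈U′ with cov₁ x x∈U′
    ...   | y , y∈ , yx = y , ∨⁺ʳ {D ph y} y∈ , yx
    bound : suc (suc i) ! * d * count (D ph ∪ˢ D₁) ≤ d * u * suc i ! + N * harmonic (suc i)
    bound = begin
      suc (suc i) ! * d * count (D ph ∪ˢ D₁)
        ≤⟨ *-monoʳ-≤ (suc (suc i) ! * d) (count-∪ (D ph) D₁) ⟩
      (2 + i) * ((1 + i) * i !) * d * (p + c)
        ≡⟨ solve 5 (λ i f d p c → (con 2 :+ i) :* ((con 1 :+ i) :* f) :* d :* (p :+ c)
             := d :* ((con 1 :+ i) :* f) :* ((con 2 :+ i) :* p) :+ (con 2 :+ i) :* ((con 1 :+ i) :* f :* d :* c))
             refl i (i !) d p c ⟩
      d * ((1 + i) * i !) * ((2 + i) * p) + (2 + i) * ((1 + i) * i ! * d * c)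
        ≤⟨ +-monoʳ-≤ (d * ((1 + i) * i !) * ((2 + i) * p)) (*-monoʳ-≤ (2 + i) bound₁) ⟩
      d * ((1 + i) * i !) * ((2 + i) * p) + (2 + i) * (d * u′ * i ! + N * h)
        ≡⟨ solve 7 (λ i f d p u N h → d :* ((con 1 :+ i) :* f) :* ((con 2 :+ i) :* p) :+ (con 2 :+ i) :* (d :* u :* f :+ N :* h)
             := d :* ((con 1 :+ i) :* f) :* ((con 2 :+ i) :* p :+ u) :+ (d :* u :* f :+ (con 2 :+ i) :* (N :* h)))
             refl i (i !) d p u′ N h ⟩
      d * ((1 + i) * i !) * ((2 + i) * p + u′) + (d * u′ * i ! + (2 + i) * (N * h))
        ≤⟨ +-mono-≤ (*-monoʳ-≤ (d * ((1 + i) * i !)) (cost ph))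
                    (+-monoˡ-≤ ((2 + i) * (N * h)) (*-monoˡ-≤ (i !) sparse)) ⟩
      d * ((1 + i) * i !) * u + ((1 + i) * N * i ! + (2 + i) * (N * h))
        ≡⟨ solve 6 (λ i f d u N h → d :* ((con 1 :+ i) :* f) :* u :+ ((con 1 :+ i) :* N :* f :+ (con 2 :+ i) :* (N :* h))
             := d :* u :* ((con 1 :+ i) :* f) :+ N :* ((con 2 :+ i) :* h :+ (con 1 :+ i) :* f))
             refl i (i !) d u N h ⟩
      d * u * suc i ! + N * harmonic (suc i) ∎
      where open ≤-Reasoning

-- The heavy vertices in `W`, at most `|W|` many, are covered greedily; those outside `W` go into
-- `D` themselves. Each of the latter sees at least `d` vertices of `W`, and a vertex of `W` sees at
-- most five of them, so there are at most `5 |W| / d`.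
cover-heavy : ∀ {n} (S : SimpleGraph n) (W heavy : VSet n) (d i : ℕ) → 1 ≤ d →
              (∀ x → x ∈ heavy → d ≤ count (λ y → W y ∧ N[ S ] y x)) →
              (∀ y → count (N[ S ] y ∩ˢ ∁ W) ≤ 5) →
              ∃ λ D → (∀ x → x ∈ heavy → ∃ λ y → y ∈ D × y ∈ N[ S ] x) ×
                suc i ! * d * count D ≤ count W * (d * i ! + harmonic i + 5 * suc i !)
cover-heavy S W heavy d i 1≤d many few with Greedy.greedy N[ S ] W d 1≤d i (heavy ∩ˢ W)
                                              (λ x x∈ → many x (proj₁ (∧⁻ {heavy x} x∈)))
... | D₁ , cov , bound = D₁ ∪ˢ U , cover , total
  where
  U = heavy ∩ˢ ∁ W
  N = count W
  rest : d * count U ≤ 5 * N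
  rest = double-count N[ S ] U W d 5
    (λ x x∈ → many x (proj₁ (∧⁻ {heavy x} x∈)))
    (λ y _ → ≤-trans (count-mono (U ∩ˢ N[ S ] y) (N[ S ] y ∩ˢ ∁ W) λ x x∈ →
       let a , b = ∧⁻ {U x} x∈ in ∧⁺ b (proj₂ (∧⁻ {heavy x} a))) (few y))
  cover : ∀ x → x ∈ heavy → ∃ λ y → y ∈ D₁ ∪ˢ U × y ∈ N[ S ] x
  cover x x∈ with ∈-dec W x
  ... | inj₂ x∉W = x , ∨⁺ʳ {D₁ x} (∧⁺ x∈ (not⁺ x∉W)) , N-refl S x
  ... | inj₁ x∈W with cov x (∧⁺ x∈ x∈W)
  ...   | y , y∈ , xy = y , ∨⁺ˡ y∈ , N-sym S xy
  total : suc i ! * d * count (D₁ ∪ˢ U) ≤ N * (d * i ! + harmonic i + 5 * suc i !)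
  total = begin
    suc i ! * d * count (D₁ ∪ˢ U)                        ≤⟨ *-monoʳ-≤ (suc i ! * d) (count-∪ D₁ U) ⟩
    suc i ! * d * (count D₁ + count U)
      ≡⟨ solve 4 (λ f d a b → f :* d :* (a :+ b)
           := f :* d :* a :+ f :* (d :* b)) refl (suc i !) d (count D₁) (count U) ⟩
    suc i ! * d * count D₁ + suc i ! * (d * count U)      ≤⟨ +-mono-≤ bound (*-monoʳ-≤ (suc i !) rest) ⟩
    (d * count (heavy ∩ˢ W) * i ! + N * harmonic i) + suc i ! * (5 * N)
      ≤⟨ +-monoˡ-≤ (suc i ! * (5 * N)) (+-monoˡ-≤ (N * harmonic i) (*-monoˡ-≤ (i !) (*-monoʳ-≤ d
           (count-mono (heavy ∩ˢ W) W λ x x∈ → proj₂ (∧⁻ {heavy x} x∈))))) ⟩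
    (d * N * i ! + N * harmonic i) + suc i ! * (5 * N)
      ≡⟨ solve 5 (λ d N f h g → (d :* N :* f :+ N :* h) :+ g :* (con 5 :* N) := N :* (d :* f :+ h :+ con 5 :* g))
           refl d N (i !) (harmonic i) (suc i !) ⟩
    N * (d * i ! + harmonic i + 5 * suc i !) ∎
    where open ≤-Reasoning

-- The numerical bound

open import Data.Integer as ℤ using (+_)
import Data.Integer.Properties as ℤₚ
import Data.Integer.Solver as ℤˢ

-- After division by the factorial this is `1/2 + 1/3 + 1/4 + … ≥ 1`; the base case is 26/24.
harmonic-≥ : ∀ m → (4 + m) ! ≤ harmonic (3 + m)
harmonic-≥ zero    = ≤ᵇ⇒≤ 24 26 tt
harmonic-≥ (suc m) = ≤-trans (*-monoʳ-≤ (5 + m) (harmonic-≥ m)) (m≤m+n _ _)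

-- Write `H` for the harmonic number of `K = suc k`. The hypotheses give
-- `K e ≤ 2 b (1 + (K/d)(H - 1) + 5 K/d)`, and `K ≤ 2 d`, `5 K ≤ 7 d` bound the bracket by
-- `8 + 2 (H - 1)`. As `H - 1 ≥ 1`, this is at most `5 H`.
deficit-bound : ∀ k d b e N → suc k ≡ 5 + d → 13 ≤ d → N ≤ 2 * b →
                suc k ! * d * e ≤ N * (d * k ! + harmonic k + 5 * suc k !) →
                suc k ! * (suc k * e) ≤ 10 * b * (harmonic k + suc k !)
deficit-bound k d b e N eq 13≤d N≤2b bound = *-cancelˡ-≤ d {{>-nonZero (≤-trans (s≤s z≤n) 13≤d)}} (begin
  d * (F * (K * e))
    ≡⟨ solve 4 (λ d F K e → d :* (F :* (K :* e)) := K :* (F :* d :* e)) refl d F K e ⟩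
  K * (F * d * e)                              ≤⟨ *-monoʳ-≤ K bound ⟩
  K * (N * (d * k ! + h + 5 * F))              ≤⟨ *-monoʳ-≤ K (*-monoˡ-≤ (d * k ! + h + 5 * F) N≤2b) ⟩
  K * (2 * b * (d * k ! + h + 5 * (K * k !)))
    ≡⟨ solve 5 (λ K b d f h → K :* (con 2 :* b :* (d :* f :+ h :+ con 5 :* (K :* f)))
         := con 2 :* b :* (d :* (K :* f) :+ (K :* h :+ con 5 :* K :* (K :* f)))) refl K b d (k !) h ⟩
  2 * b * (d * F + (K * h + 5 * K * F))
    ≤⟨ *-monoʳ-≤ (2 * b) (+-monoʳ-≤ (d * F) (+-mono-≤ (*-monoˡ-≤ h K≤2d) (*-monoˡ-≤ F 5K≤7d))) ⟩
  2 * b * (d * F + (2 * d * h + 7 * d * F))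
    ≡⟨ solve 4 (λ b d F h → con 2 :* b :* (d :* F :+ (con 2 :* d :* h :+ con 7 :* d :* F))
         := con 2 :* b :* (con 5 :* d :* F :+ con 2 :* d :* h :+ con 3 :* d :* F)) refl b d F h ⟩
  2 * b * (5 * d * F + 2 * d * h + 3 * d * F)
    ≤⟨ *-monoʳ-≤ (2 * b) (+-monoʳ-≤ (5 * d * F + 2 * d * h) (*-monoʳ-≤ (3 * d) F≤h)) ⟩
  2 * b * (5 * d * F + 2 * d * h + 3 * d * h)
    ≡⟨ solve 4 (λ b d F h → con 2 :* b :* (con 5 :* d :* F :+ con 2 :* d :* h :+ con 3 :* d :* h)
         := d :* (con 10 :* b :* (h :+ F))) refl b d F h ⟩
  d * (10 * b * (h + F))                       ∎)
  where
  open ≤-Reasoning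
  K = suc k
  F = suc k !
  h = harmonic k
  K≤2d : K ≤ 2 * d
  K≤2d = ≤-trans (≤-reflexive eq) (≤-trans (+-monoˡ-≤ d (≤-trans (m≤m+n 5 8) 13≤d))
           (≤-reflexive (solve 1 (λ d → d :+ d := con 2 :* d) refl d)))
  -- With `K = 5 + d` this amounts to `25 ≤ 2 d`, whence `13 ≤ d`.
  5K≤7d : 5 * K ≤ 7 * d
  5K≤7d = begin
    5 * K            ≡⟨ cong (5 *_) eq ⟩
    5 * (5 + d)      ≡⟨ solve 1 (λ d → con 5 :* (con 5 :+ d) := con 25 :+ con 5 :* d) refl d ⟩
    25 + 5 * d       ≤⟨ +-monoˡ-≤ (5 * d) (≤-trans (m≤m+n 25 1) (*-monoʳ-≤ 2 13≤d)) ⟩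
    2 * d + 5 * d    ≡⟨ solve 1 (λ d → con 2 :* d :+ con 5 :* d := con 7 :* d) refl d ⟩
    7 * d            ∎
  3≤k : 3 ≤ k
  3≤k = ≤-pred (≤-trans (m≤m+n 4 1) (≤-trans (m≤m+n 5 d) (≤-reflexive (sym eq))))
  F≤h : F ≤ h
  F≤h = subst (λ i → suc i ! ≤ harmonic i) (m+[n∸m]≡n 3≤k) (harmonic-≥ (k ∸ 3))

-- With `H` as before, `a ≥ b - 3 e` and `K e ≤ 10 b H` give `K a ≥ K b - 30 b H`, which is the
-- origin of the constant 30. Rearranged, the fraction in `LeafBound` is at most `H - 1`.
leafBound : ∀ k a b e → b ≤ a + 3 * e → suc k ! * (suc k * e) ≤ 10 * b * (harmonic k + suc k !) →
            LeafBound k a b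
leafBound k a zero    e _   _     = tt
-- `30 * suc b` unfolds to `suc (b + 29 * suc b)`, the successor form of the denominator.
leafBound k a (suc b) e b≤a bound = lnGe-harmonic k ((+ K ℤ.- + 30) ℤ.* + B ℤ.- + K ℤ.* + a) (b + 29 * B) (begin
  ((+ K ℤ.- + 30) ℤ.* + B ℤ.- + K ℤ.* + a) ℤ.* + F
    ≡⟨ ℤˢ.+-*-Solver.solve 4 (λ K B a F → ((K ⊖ c 30) ⊗ B ⊖ K ⊗ a) ⊗ F
         ≔ K ⊗ B ⊗ F ⊖ (K ⊗ a ⊗ F ⊕ c 30 ⊗ B ⊗ F)) refl (+ K) (+ B) (+ a) (+ F) ⟩
  + K ℤ.* + B ℤ.* + F ℤ.- (+ K ℤ.* + a ℤ.* + F ℤ.+ + 30 ℤ.* + B ℤ.* + F)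
    ≤⟨ ℤₚ.+-monoˡ-≤ (ℤ.- (+ K ℤ.* + a ℤ.* + F ℤ.+ + 30 ℤ.* + B ℤ.* + F)) lifted ⟩
  (+ K ℤ.* + a ℤ.* + F ℤ.+ + 30 ℤ.* + B ℤ.* (+ h ℤ.+ + F)) ℤ.- (+ K ℤ.* + a ℤ.* + F ℤ.+ + 30 ℤ.* + B ℤ.* + F)
    ≡⟨ ℤˢ.+-*-Solver.solve 5 (λ K B a F h → (K ⊗ a ⊗ F ⊕ c 30 ⊗ B ⊗ (h ⊕ F)) ⊖ (K ⊗ a ⊗ F ⊕ c 30 ⊗ B ⊗ F)
         ≔ h ⊗ (c 30 ⊗ B)) refl (+ K) (+ B) (+ a) (+ F) (+ h) ⟩
  + h ℤ.* (+ 30 ℤ.* + B)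
    ≡⟨ cong (+ h ℤ.*_) (sym (ℤₚ.pos-* 30 B)) ⟩
  + h ℤ.* + (30 * B) ∎)
  where
  open ℤₚ.≤-Reasoning
  open ℤˢ.+-*-Solver using () renaming (_:+_ to _⊕_; _:-_ to _⊖_; _:*_ to _⊗_; _:=_ to _≔_; con to cn)
  c : ∀ {n} → ℕ → ℤˢ.+-*-Solver.Polynomial n
  c m = cn (+ m)
  K = suc k
  B = suc b
  F = suc k !
  h = harmonic k
  natural : K * B * F ≤ K * a * F + 30 * B * (h + F)
  natural = N.begin
    K * B * F                              N.≤⟨ *-monoˡ-≤ F (*-monoʳ-≤ K b≤a) ⟩
    K * (a + 3 * e) * F
      N.≡⟨ solve 4 (λ K a e F → K :* (a :+ con 3 :* e) :* F := K :* a :* F :+ con 3 :* (F :* (K :* e))) refl K a e F ⟩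
    K * a * F + 3 * (F * (K * e))          N.≤⟨ +-monoʳ-≤ (K * a * F) (*-monoʳ-≤ 3 bound) ⟩
    K * a * F + 3 * (10 * B * (h + F))
      N.≡⟨ cong (_+_ (K * a * F)) (solve 2 (λ B x → con 3 :* (con 10 :* B :* x) := con 30 :* B :* x) refl B (h + F)) ⟩
    K * a * F + 30 * B * (h + F)           N.∎
    where module N = ≤-Reasoning
  pos-*³ : ∀ x y z → + (x * y * z) ≡ + x ℤ.* + y ℤ.* + z
  pos-*³ x y z = trans (ℤₚ.pos-* (x * y) z) (cong (ℤ._* + z) (ℤₚ.pos-* x y))
  lifted : + K ℤ.* + B ℤ.* + F ℤ.≤ + K ℤ.* + a ℤ.* + F ℤ.+ + 30 ℤ.* + B ℤ.* (+ h ℤ.+ + F)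
  lifted = subst₂ ℤ._≤_ (pos-*³ K B F) (cong₂ ℤ._+_ (pos-*³ K a F) (pos-*³ 30 B (h + F))) (ℤ.+≤+ natural)

-- The internal vertices of a spanning tree

module Internal {n} (G T : SimpleGraph n) (T⊆G : Subgraph T G) (conn : Connected T) (2<n : 2 < n) where

  I : VSet n
  I x = not (deg T x ≡ᵇ 1)

  ∉I : ∀ {x} → x ∉ I → deg T x ≡ 1
  ∉I {x} h with deg T x
  ... | 1 = refl

  count-I : leaves T + count I ≡ n
  count-I = trans (cong (_+ count I) (leaves≡count T)) (count-∁ (λ x → deg T x ≡ᵇ 1))

  -- Two adjacent leaves have no neighbours but each other, so no third vertex is reachable from
  -- them.
  leaves-nonadjacent : ∀ {x y} → x ∉ I → y ∉ I → Edge T x y → ⊥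
  leaves-nonadjacent {x} {y} x∉ y∉ xy = <⇒≱ 2<n (begin
    n                             ≡⟨ count-all (λ z → [ (λ { refl → ∨⁺ˡ (∈⁅⁆ x) }) , (λ { refl → ∨⁺ʳ {⁅ x ⁆ y} (∈⁅⁆ y) }) ]′
           (trapped (inj₁ refl) (conn x z))) ⟨
    count (⁅ x ⁆ ∪ˢ ⁅ y ⁆)        ≤⟨ count-∪ ⁅ x ⁆ ⁅ y ⁆ ⟩
    count ⁅ x ⁆ + count ⁅ y ⁆     ≡⟨ cong₂ _+_ (count-⁅⁆ x) (count-⁅⁆ y) ⟩
    2                             ∎)
    where
    open ≤-Reasoning
    trapped : ∀ {u z} → u ≡ x ⊎ u ≡ y → Reachable T u z → z ≡ x ⊎ z ≡ y
    trapped u Reachable.here = u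
    trapped (inj₁ refl) (Reachable.step e p) = trapped (inj₂ (count-unique {p = adj T x} (∉I x∉) e xy)) p
    trapped (inj₂ refl) (Reachable.step e p) = trapped (inj₁ (count-unique {p = adj T y} (∉I y∉) e (edge-sym T xy))) p

  I-dominates : ∀ x → ∃ λ y → y ∈ I × y ∈ N[ G ] x
  I-dominates x with ∈-dec I x
  ... | inj₁ x∈ = x , x∈ , N-refl G x
  ... | inj₂ x∉ with count-pos {p = adj T x} (≤-reflexive (sym (∉I x∉)))
  ...   | y , xy = y , ¬-not (λ y∉ → leaves-nonadjacent x∉ y∉ xy) , N-edge G (T⊆G x y xy)

  -- A walk that enters a leaf must return at once to the vertex it came from; such excursions are
  -- cut out.
  walk : ∀ {x y} → x ∈ I → y ∈ I → Reachable T x y → Walk G I x y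
  walk x∈ y∈ Reachable.here = stop x∈
  walk x∈ y∈ (Reachable.step {x} {z} xz p) with ∈-dec I z
  ... | inj₁ z∈ = step x∈ (T⊆G x z xz) (walk z∈ y∈ p)
  ... | inj₂ z∉ with p
  ...   | Reachable.here = ⊥-elim (true≢false y∈ z∉)
  ...   | Reachable.step {y = w} zw q
    rewrite count-unique {p = adj T z} (∉I z∉) zw (edge-sym T xz) = walk x∈ y∈ q

-- Heavy vertices and the comparison of leaf numbers

light-edges-kept : ∀ {n k} {G S : SimpleGraph n} → IsSk k G S → ∀ {x} → deg G x ≤ k → ∀ y → Edge G x y → Edge S x y
light-edges-kept {G = G} {S} (S⊆G , degS) {x} light = count-full {p = adj S x} {q = adj G x} (S⊆G x)
  (≤-trans (≤-reflexive (sym (m≤n⇒m⊓n≡m light))) (degS x))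

heavy : ∀ {n} → ℕ → SimpleGraph n → VSet n
heavy k G x = does (k ≤? deg G x)

heavy⁻ : ∀ {n k} (G : SimpleGraph n) {x} → x ∈ heavy k G → k ≤ deg G x
heavy⁻ {k = k} G {x} = does⁻ (k ≤? deg G x)

light⁻ : ∀ {n k} (G : SimpleGraph n) {x} → x ∉ heavy k G → deg G x ≤ k
light⁻ {k = k} G {x} light = ≰⇒≥ λ le → true≢false (dec-true (k ≤? deg G x) le) light

dominate-heavy : ∀ {n} k d {G S : SimpleGraph n} → suc k ≡ 5 + d → 1 ≤ d → IsSk k G S →
                 ∀ W → (∀ x → count (N[ G ] x ∩ˢ ∁ W) ≤ 5) →
                 ∃ λ D → (∀ x → x ∈ heavy k G → ∃ λ y → y ∈ D × y ∈ N[ S ] x) ×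
                   suc k ! * d * count D ≤ count W * (d * k ! + harmonic k + 5 * suc k !)
dominate-heavy k d {G} {S} K≡5+d 1≤d (S⊆G , degS) W fewG =
  cover-heavy S W (heavy k G) d k 1≤d (λ x x∈ → ≤-trans (many x x∈) (flip x)) few
  where
  few : ∀ x → count (N[ S ] x ∩ˢ ∁ W) ≤ 5
  few x = ≤-trans (count-mono (N[ S ] x ∩ˢ ∁ W) (N[ G ] x ∩ˢ ∁ W) λ y y∈ →
    let p , q = ∧⁻ {N[ S ] x y} y∈ in ∧⁺ (N-mono {H = S} {G} S⊆G x y p) q) (fewG x)
  flip : ∀ x → count (N[ S ] x ∩ˢ W) ≤ count (λ y → W y ∧ N[ S ] y x)
  flip x = count-mono (N[ S ] x ∩ˢ W) (λ y → W y ∧ N[ S ] y x) λ y y∈ →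
    let p , q = ∧⁻ {N[ S ] x y} y∈ in ∧⁺ q (N-sym S p)
  -- A heavy vertex has at least `k` neighbours in `S`, hence together with itself at least
  -- `suc k = 5 + d` closed neighbours, of which at most five lie outside `W`.
  many : ∀ x → x ∈ heavy k G → d ≤ count (N[ S ] x ∩ˢ W)
  many x x∈ = +-cancelʳ-≤ 5 d (count (N[ S ] x ∩ˢ W)) (begin
    d + 5                                                ≡⟨ trans (+-comm d 5) (sym K≡5+d) ⟩
    suc k                                                ≡⟨ cong suc (m≥n⇒m⊓n≡n (heavy⁻ G x∈)) ⟨
    suc (deg G x ⊓ k)                                    ≤⟨ s≤s (degS x) ⟩
    suc (deg S x)
      ≤⟨ count-< {p = adj S x} {q = N[ S ] x} {x} (λ y → N-edge S) (N-refl S x) (irrefl S x) ⟩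
    count (N[ S ] x)                                     ≡⟨ count-split (N[ S ] x) W ⟨
    count (N[ S ] x ∩ˢ W) + count (N[ S ] x ∩ˢ ∁ W)      ≤⟨ +-monoʳ-≤ (count (N[ S ] x ∩ˢ W)) (few x) ⟩
    count (N[ S ] x ∩ˢ W) + 5                            ∎)
    where open ≤-Reasoning

-- At least `n - |I| - 3 |D|` vertices lie outside the joined set `X` and become leaves of a
-- spanning tree of `S ∪ T`, while `leaves T₀ = n - |I|`. Connectedness of `S ∪ T` comes from `T`,
-- domination of the heavy vertices from `S`.
leaf-deficit : ∀ {n k} {G S T T₀ : SimpleGraph n} → IsSk k G S → Connected T →
               Subgraph T₀ G → Connected T₀ → 2 < n →
               ∀ a → (∀ T₁ → IsSpanningTree (S ∪ T) T₁ → leaves T₁ ≤ a) →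
               ∀ D → (∀ x → x ∈ heavy k G → ∃ λ y → y ∈ D × y ∈ N[ S ] x) →
               leaves T₀ ≤ a + 3 * count D
leaf-deficit {n} {k} {G} {S} {T} {T₀} sk connT T₀⊆G connT₀ 2<n a max-a D dom = conclude joined
  where
  open Internal G T₀ T₀⊆G connT₀ 2<n
  kept : ∀ x y → Edge G x y → x ∉ heavy k G → Edge (S ∪ T) x y
  kept x y e light = ∨⁺ˡ (light-edges-kept {G = G} {S} sk (light⁻ G light) y e)
  I-dom : ∀ q → q ∉ heavy k G → ∃ λ y → y ∈ I × y ∈ N[ S ∪ T ] q
  I-dom q light with I-dominates q
  ... | y , y∈I , y∈N with N⁻ G y∈N
  ...   | inj₁ refl = q , y∈I , N-refl (S ∪ T) q
  ...   | inj₂ e    = y , y∈I , N-edge (S ∪ T) (kept q y e light)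
  D-dom : ∀ q → q ∈ heavy k G → ∃ λ y → y ∈ D × y ∈ N[ S ∪ T ] q
  D-dom q q∈ with dom q q∈
  ... | y , y∈D , y∈N = y , y∈D , N-mono {H = S} {S ∪ T} (λ _ _ → ∨⁺ˡ) q y y∈N
  conn∪ : Connected (S ∪ T)
  conn∪ x y = go (connT x y)
    where
    go : ∀ {x y} → Reachable T x y → Reachable (S ∪ T) x y
    go Reachable.here = Reachable.here
    go (Reachable.step {x} {y} e p) = Reachable.step (∨⁺ʳ {adj S x y} e) (go p)
  joined : ∃ λ r → ∃ λ X → Grown (S ∪ T) r X × Dominates (S ∪ T) X × count X ≤ count I + 3 * count D
  -- Applied to an arbitrary vertex, domination shows that `I` is nonempty and supplies the root.
  joined with I-dominates (fromℕ< 2<n)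
  ... | r , r∈I , _ = r , Join.join G (S ∪ T) conn∪ I D (heavy k G) kept I-dom D-dom r r∈I
                            λ y y∈I → walk y∈I r∈I (connT₀ y r)
  conclude : (∃ λ r → ∃ λ X → Grown (S ∪ T) r X × Dominates (S ∪ T) X × count X ≤ count I + 3 * count D) →
             leaves T₀ ≤ a + 3 * count D
  conclude (r , X , grown , dom∪ , X≤) with cds-tree grown dom∪
  ... | T₁ , span , ∁X≤ = +-cancelʳ-≤ (count I) (leaves T₀) (a + 3 * count D) (begin
    leaves T₀ + count I              ≡⟨ trans count-I (sym (count-∁ X)) ⟩
    count X + count (∁ X)            ≤⟨ +-mono-≤ X≤ (≤-trans ∁X≤ (max-a T₁ span)) ⟩
    count I + 3 * count D + a
      ≡⟨ solve 3 (λ i d a → i :+ con 3 :* d :+ a := a :+ con 3 :* d :+ i) refl (count I) (count D) a ⟩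
    a + 3 * count D + count I        ∎)
    where open ≤-Reasoning

theorem6 : ∀ (k : ℕ) → 186 ≤ k →
    ∀ {n} (G : SimpleGraph n) → Connected G →
    ∀ (S T : SimpleGraph n) → IsSk k G S → IsSpanningTree G T →
    ∀ (a b : ℕ) → IsLeafNumber (S ∪ T) a → IsLeafNumber G b →
    LeafBound k a b
theorem6 k 186≤k {n} G connG S T sk (_ , connT , _) a b (_ , max-a)
    ((T₀ , (T₀⊆G , connT₀ , acyclicT₀) , leaves≡b) , max-b) = [ some-heavy , all-light ]′ (search (heavy k G))
  where
  d : ℕ
  -- The surplus of `suc k` closed neighbours over the five that `W` may miss.
  d = k ∸ 4
  182≤d : 182 ≤ d
  182≤d = ∸-monoˡ-≤ 4 186≤k
  K≡5+d : suc k ≡ 5 + d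
  K≡5+d = cong suc (sym (m+[n∸m]≡n (≤-trans (m≤m+n 4 182) 186≤k)))
  -- Without heavy vertices `S` keeps all edges of `G`, so the optimal tree `T₀` survives and the
  -- deficit is 0. In the other case a heavy vertex supplies the root of positive degree and
  -- `2 < n`.
  all-light : (∀ x → x ∉ heavy k G) → LeafBound k a b
  all-light light = leafBound k a b 0
    (≤-trans (≤-trans (≤-reflexive (sym leaves≡b)) (max-a T₀ (T₀⊆∪ , connT₀ , acyclicT₀))) (m≤m+n a 0))
    (≤-trans (≤-reflexive (trans (cong (suc k ! *_) (*-zeroʳ k)) (*-zeroʳ (suc k !)))) z≤n)
    where
    T₀⊆∪ : Subgraph T₀ (S ∪ T)
    T₀⊆∪ x y e = ∨⁺ˡ (light-edges-kept {G = G} {S} sk (light⁻ G (light x)) y (T₀⊆G x y e))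
  some-heavy : (∃ λ x → x ∈ heavy k G) → LeafBound k a b
  some-heavy (r , r∈) = with-W (Absorb.absorbing-set G connG r (≤-trans (m≤m+n 1 185) 186≤deg) b max-b)
    where
    186≤deg : 186 ≤ deg G r
    186≤deg = ≤-trans 186≤k (heavy⁻ G r∈)
    2<n : 2 < n
    2<n = ≤-trans (m≤m+n 3 183) (≤-trans 186≤deg (count≤n (adj G r)))
    with-W : (∃ λ W → count W ≤ 2 * b × (∀ x → count (N[ G ] x ∩ˢ ∁ W) ≤ 5)) → LeafBound k a b
    with-W (W , W≤2b , few) = with-D (dominate-heavy k d {G} {S} K≡5+d (≤-trans (m≤m+n 1 181) 182≤d) sk W few)
      where
      with-D : (∃ λ D → (∀ x → x ∈ heavy k G → ∃ λ y → y ∈ D × y ∈ N[ S ] x) ×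
                 suc k ! * d * count D ≤ count W * (d * k ! + harmonic k + 5 * suc k !)) → LeafBound k a b
      with-D (D , dom , bound) = leafBound k a b (count D)
        (≤-trans (≤-reflexive (sym leaves≡b))
          (leaf-deficit {k = k} {G} {S} {T} {T₀} sk connT T₀⊆G connT₀ 2<n a max-a D dom))
        (deficit-bound k d b (count D) (count W) K≡5+d (≤-trans (m≤m+n 13 169) 182≤d) W≤2b bound)
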